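{- Let $n$ be a positive integer and let $P_1, P_2, \ldots, P_n \in \mathbb{Z}[x]$ be arbitrary. Then there exists a polynomial $D \in \mathbb{Z}[x]$ such that $$S(D) = S(P_1) \cap S(P_2) \cap \cdots \cap S(P_n).$$
   Context: For $P \in \mathbb{Z}[x]$, $S(P)$ denotes the set of prime divisors of $P$, i.e. the set of primes $p$ such that $p \mid P(m)$ for some integer $m$. -}

module Defs where

open import Data.Nat using (ℕ)
open import Data.Nat.Primality using (Prime)
open import Data.Integer using (ℤ; +_; _+_; _*_)
open import Data.Integer.Divisibility using (_∣_)
open import Data.List using (List; []; _∷_)
open import Data.Product using (Σ; _×_)

-- A polynomial in ℤ[x], represented by its list of coefficients,
-- constant term first: a₀ ∷ a₁ ∷ … ∷ a_d ∷ [] denotes a₀ + a₁ x + … + a_d x^d.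
-- (Trailing zeros are allowed; they do not change the evaluation map.)
Poly : Set
Poly = List ℤ

eval : Poly → ℤ → ℤ
eval []       x = + 0
eval (a ∷ as) x = a + x * eval as x

S : Poly → ℕ → Set
S P p = Prime p × Σ ℤ (λ m → (+ p) ∣ eval P m)

{-# OPTIONS --safe #-}
module Submission where

-- It suffices to intersect two sets, and to do so up to finitely many primes: if c₀ = D(c) ≠ 0 and
-- N′ = c₀ N, then D(c + c₀ N′ x) / c₀ is integral and loses exactly the primes dividing N′; those that
-- are wanted come back by multiplying with a constant.
--
-- Up to finitely many primes P and Q may be taken monic, and P separable: otherwise gcd(P, P′) splits P
-- and S(UV) = S(U) ∪ S(V).  Let A = ℤ[x, y]/(P(x), Q(y)), γ = y + t x for a suitable integer t, and let
-- D be the minimal polynomial of γ.  If P(α) ≡ Q(β) ≡ 0 (mod p) then D(β + t α) ≡ 0.  Conversely, by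
-- minimality there is a functional τ on A vanishing on γⁱ for i < deg D − 1 but not for i = deg D − 1.
-- If D(m) ≡ 0 and E(z) = (D(z) − D(m)) / (z − m), then φ(a) = τ(E(γ) a) satisfies φ(γ a) ≡ m φ(a), and
-- φ(1) is a nonzero constant.  Separability gives N (x₁ − x₂) ∈ (γ₁ − γ₂) in A ⊗ A with N ≠ 0, for
-- generic t: with u = x₁ − x₂ and v = y₁ − y₂ one has n₀ u = u² r, the element v r is algebraic over ℤ,
-- and t only has to avoid the roots of its equation.  Applying φ ⊗ φ yields φ(1) φ(x a) ≡ φ(x) φ(a), so
-- φ is an eigenvector of x and of y = γ − t x; the eigenvalues are roots of P and Q modulo p.
--
-- Functionals on A are represented by their values on monomials, that is, by sequences satisfying the
-- recurrences P and Q, and A by polynomial expressions acting on such sequences.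

open import Defs
open import Data.Nat using (ℕ; suc)
open import Data.Fin using (Fin)
open import Data.Product using (Σ)
open import Function.Bundles using (_⇔_)

open import Algebra.Bundles using (CommutativeRing)
import Algebra.Solver.Ring
open import Algebra.Solver.Ring.AlmostCommutativeRing using (fromCommutativeRing; _-Raw-AlmostCommutative⟶_)
open import Data.Fin using (zero; suc; toℕ; fromℕ<)
open import Data.Fin.Properties using (any?; toℕ-fromℕ<)
open import Data.Integer using (ℤ; +_; -[1+_]; _+_; _*_; -_; ∣_∣; 0ℤ; 1ℤ; _^_)
open import Data.Integer.DivMod using (_/ℕ_; a≡a%ℕn+[a/ℕn]*n; n%ℕd<d)
import Data.Integer.Divisibility as Unsigned
open import Data.Integer.Divisibility.Signed using (divides; ∣ᵤ⇒∣; ∣⇒∣ᵤ)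
open import Data.Integer.Properties using (pos-+; pos-*; *-zeroʳ; +-identityˡ; +-identityʳ; i*j≡0⇒i≡0∨j≡0; +-*-commutativeRing)
import Data.Integer.Properties as ℤ
open import Data.Integer.Tactic.RingSolver using (solve; solve-∀)
open import Data.List using (List; []; _∷_; _++_; _∷ʳ_; map; length; replicate; filter; upTo; downFrom; cartesianProductWith)
open import Data.List.Membership.Propositional.Properties using (∈-filter⁺; ∈-filter⁻; ∈-upTo⁺)
open import Data.List.Properties using (length-map; length-replicate)
open import Data.List.Relation.Unary.All as All using (All)
open import Data.List.Relation.Unary.All.Properties using (map⁺; map⁻; ++⁺; all-filter)
open import Data.Maybe using (Maybe; just; nothing)
open import Data.Nat as ℕ using (zero; z≤n; s≤s)
open import Data.Nat.Coprimality using (Coprime; coprime-Bézout)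
import Data.Nat.Divisibility as ℕ
open import Data.Nat.GCD using (module Bézout)
open import Data.Nat.ListAction using (product)
open import Data.Nat.ListAction.Properties using (∈⇒∣product)
open import Data.Nat.Primality using (Prime; prime?; prime⇒irreducible; prime⇒nonZero)
open import Data.Nat.Primality.Factorisation using (factorisationHasAllPrimeFactors)
import Data.Nat.Properties as ℕ
open import Data.Product using (∃; _×_; _,_; proj₁; proj₂)
open import Data.Sum using (_⊎_; inj₁; inj₂; [_,_]′)
open import Function using (_∘_)
open import Function.Bundles using (mk⇔; Equivalence)
open import Level using (0ℓ)
open import Relation.Binary.Bundles using (Setoid)
open import Relation.Binary.PropositionalEquality using (_≡_; _≢_; refl; sym; trans; cong; cong₂; subst; module ≡-Reasoning)
import Relation.Binary.Reasoning.Setoid as SetoidReasoning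
open import Relation.Nullary using (¬_; Dec; yes; no; contradiction)
open import Relation.Nullary.Decidable using (map′; _×-dec_)

-- Congruences modulo an integer

infix 4 _≋_[_]

-- The quotient is kept as data and the equation is solved for `a`, so matching it with `refl` turns
-- the laws of congruences into ring identities.
record _≋_[_] (a b q : ℤ) : Set where
  constructor by-multiple
  field
    multiple : ℤ
    equation : a ≡ b + multiple * q

≡⇒≋ : ∀ {q a b} → a ≡ b → a ≋ b [ q ]
≡⇒≋ {q} {b = b} refl = by-multiple 0ℤ (sym (+-identityʳ b))

≋-refl : ∀ {q a} → a ≋ a [ q ]
≋-refl = ≡⇒≋ refl

≋-sym : ∀ {q a b} → a ≋ b [ q ] → b ≋ a [ q ]
≋-sym {q} {b = b} (by-multiple k refl) = by-multiple (- k) (solve (b ∷ k ∷ q ∷ []))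

≋-trans : ∀ {q a b c} → a ≋ b [ q ] → b ≋ c [ q ] → a ≋ c [ q ]
≋-trans {q} {c = c} (by-multiple k refl) (by-multiple l refl) = by-multiple (l + k) (solve (c ∷ k ∷ l ∷ q ∷ []))

≋-setoid : ℤ → Setoid 0ℓ 0ℓ
≋-setoid q = record { Carrier = ℤ ; _≈_ = λ a b → a ≋ b [ q ] ; isEquivalence = record { refl = ≋-refl ; sym = ≋-sym ; trans = ≋-trans } }

module ≋-Reasoning (q : ℤ) = SetoidReasoning (≋-setoid q)

≋-+ : ∀ {q a b c d} → a ≋ b [ q ] → c ≋ d [ q ] → a + c ≋ b + d [ q ]
≋-+ {q} {b = b} {d = d} (by-multiple k refl) (by-multiple l refl) =
  by-multiple (k + l) (solve (b ∷ d ∷ k ∷ l ∷ q ∷ []))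

≋-* : ∀ {q a b c d} → a ≋ b [ q ] → c ≋ d [ q ] → a * c ≋ b * d [ q ]
≋-* {q} {b = b} {d = d} (by-multiple k refl) (by-multiple l refl) =
  by-multiple (b * l + k * d + k * l * q) (solve (b ∷ d ∷ k ∷ l ∷ q ∷ []))

≋-+ˡ : ∀ {q b d} c → b ≋ d [ q ] → c + b ≋ c + d [ q ]
≋-+ˡ c = ≋-+ {a = c} ≋-refl

≋-+ʳ : ∀ {q b d} c → b ≋ d [ q ] → b + c ≋ d + c [ q ]
≋-+ʳ c eq = ≋-+ {c = c} eq ≋-refl

≋-*ˡ : ∀ {q b d} c → b ≋ d [ q ] → c * b ≋ c * d [ q ]
≋-*ˡ c = ≋-* {a = c} ≋-refl

≋-*ʳ : ∀ {q b d} c → b ≋ d [ q ] → b * c ≋ d * c [ q ]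
≋-*ʳ c eq = ≋-* {c = c} eq ≋-refl

≋-neg : ∀ {q a b} → a ≋ b [ q ] → - a ≋ - b [ q ]
≋-neg {q} {b = b} (by-multiple k refl) = by-multiple (- k) (solve (b ∷ k ∷ q ∷ []))

-- Congruence modulo 0 is equality, so integer sequences are the case q = 0.
≋0⇒≡ : ∀ {a b} → a ≋ b [ 0ℤ ] → a ≡ b
≋0⇒≡ {b = b} (by-multiple k refl) = solve (b ∷ k ∷ [])

∣⇒≋0 : ∀ {q a} → q Unsigned.∣ a → a ≋ 0ℤ [ q ]
∣⇒≋0 {q} {a} d with ∣ᵤ⇒∣ {q} {a} d
... | divides k eq = by-multiple k (trans eq (sym (ℤ.+-identityˡ (k * q))))

≋0⇒∣ : ∀ {q a} → a ≋ 0ℤ [ q ] → q Unsigned.∣ a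
≋0⇒∣ {q} (by-multiple k refl) = ∣⇒∣ᵤ (divides k (ℤ.+-identityˡ (k * q)))

prime∤⇒coprime : ∀ {p n} → Prime p → ¬ (p ℕ.∣ n) → Coprime n p
prime∤⇒coprime pr p∤n (d∣n , d∣p) with prime⇒irreducible pr d∣p
... | inj₁ d≡1 = d≡1
... | inj₂ refl = contradiction d∣n p∤n

inverse-ℕ : ∀ {p n} → Prime p → ¬ (p ℕ.∣ n) → ∃ λ c → c * + n ≋ 1ℤ [ + p ]
inverse-ℕ {p} {n} pr p∤n with coprime-Bézout (prime∤⇒coprime pr p∤n)
... | Bézout.+- x y eq = + x , by-multiple (+ y)
        (trans (sym (pos-* x n)) (trans (cong +_ (sym eq)) (trans (pos-+ 1 (y ℕ.* p)) (cong (λ z → 1ℤ + z) (pos-* y p)))))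
... | Bézout.-+ x y eq = - + x , by-multiple (- + y) (lemma (+ x) (+ n) (+ y) (+ p) eq′)
  where
  eq′ : 1ℤ + + x * + n ≡ + y * + p
  eq′ = trans (cong (λ z → 1ℤ + z) (sym (pos-* x n))) (trans (cong +_ eq) (pos-* y p))
  lemma : ∀ a b c d → 1ℤ + a * b ≡ c * d → - a * b ≡ 1ℤ + - c * d
  lemma a b c d e = begin
    - a * b               ≡⟨ solve (a ∷ b ∷ []) ⟩
    1ℤ + - (1ℤ + a * b)   ≡⟨ cong (λ z → 1ℤ + - z) e ⟩
    1ℤ + - (c * d)        ≡⟨ solve (c ∷ d ∷ []) ⟩
    1ℤ + - c * d          ∎
    where open ≡-Reasoning

inverse : ∀ {p} a → Prime p → ¬ (a ≋ 0ℤ [ + p ]) → ∃ λ c → c * a ≋ 1ℤ [ + p ]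
inverse (+ n) pr a≢0 = inverse-ℕ pr (a≢0 ∘ ∣⇒≋0)
inverse { p } -[1+ n ] pr a≢0 with inverse-ℕ {n = suc n} pr (a≢0 ∘ ∣⇒≋0)
... | c , eq = - c , ≋-trans (≡⇒≋ (lemma c (+ suc n))) eq
  where
  lemma : ∀ a b → - a * - b ≡ a * b
  lemma = solve-∀

cancel : ∀ {p} a b → Prime p → ¬ (a ≋ 0ℤ [ + p ]) → a * b ≋ 0ℤ [ + p ] → b ≋ 0ℤ [ + p ]
cancel a b pr a≢0 ab≋0 with inverse a pr a≢0
... | c , ca≋1 = begin
  b              ≡⟨ solve (b ∷ []) ⟩
  1ℤ * b         ≈⟨ ≋-*ʳ b (≋-sym ca≋1) ⟩
  c * a * b      ≡⟨ solve (a ∷ b ∷ c ∷ []) ⟩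
  c * (a * b)    ≈⟨ ≋-*ˡ c ab≋0 ⟩
  c * 0ℤ         ≡⟨ *-zeroʳ c ⟩
  0ℤ             ∎
  where open ≋-Reasoning _

-- Polynomial arithmetic

infixl 6 _⊞_
infixl 7 _⊠_

_⊞_ : Poly → Poly → Poly
[]      ⊞ q       = q
(a ∷ p) ⊞ []      = a ∷ p
(a ∷ p) ⊞ (b ∷ q) = (a + b) ∷ (p ⊞ q)

scale : ℤ → Poly → Poly
scale c = map (c *_)

_⊠_ : Poly → Poly → Poly
[]      ⊠ q = []
(a ∷ p) ⊠ q = scale a q ⊞ (0ℤ ∷ p ⊠ q)

_∘ₚ_ : Poly → Poly → Poly
[]      ∘ₚ q = []
(a ∷ p) ∘ₚ q = (a ∷ []) ⊞ q ⊠ (p ∘ₚ q)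

derivative : Poly → Poly
derivative []      = []
derivative (a ∷ p) = p ⊞ (0ℤ ∷ derivative p)

-- The synthetic-division quotient (P(z) − P(m)) / (z − m).
quotientAt : ℤ → Poly → Poly
quotientAt m []      = []
quotientAt m (a ∷ p) = p ⊞ scale m (quotientAt m p)

coeff : Poly → ℕ → ℤ
coeff []      i       = 0ℤ
coeff (a ∷ p) zero    = a
coeff (a ∷ p) (suc i) = coeff p i

IsZero : Poly → Set
IsZero = All (_≡ 0ℤ)

-- Evaluation in commutative ℤ-algebras

record ℤ-Algebra : Set₁ where
  field
    commutativeRing : CommutativeRing 0ℓ 0ℓ
    structureMap    : CommutativeRing.rawRing +-*-commutativeRing -Raw-AlmostCommutative⟶ fromCommutativeRing commutativeRing
  open CommutativeRing commutativeRing public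
    using (Carrier; setoid; +-cong; +-congˡ; +-congʳ; *-congˡ; *-congʳ; -‿cong)
    renaming (_+_ to _+ᴿ_; _*_ to _*ᴿ_; -_ to -ᴿ_; _≈_ to _≈ᴿ_; refl to ≈-refl; sym to ≈-sym; trans to ≈-trans)
  open _-Raw-AlmostCommutative⟶_ structureMap public renaming (⟦_⟧ to ι)

module Evaluation (A : ℤ-Algebra) where
  open ℤ-Algebra A public
  module ≈ᴿ-Reasoning = SetoidReasoning setoid
  open ≈ᴿ-Reasoning

  -- Coefficient test for the ring solver; `ι` may fail to be injective, so unequal integers give no
  -- answer instead of a refutation.
  decide : ∀ a b → Maybe (ι a ≈ᴿ ι b)
  decide a b with a ℤ.≟ b
  ... | yes refl = just ≈-refl
  ... | no  _    = nothing

  open Algebra.Solver.Ring (CommutativeRing.rawRing +-*-commutativeRing) (fromCommutativeRing commutativeRing) structureMap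
    decide public using (_:+_; _:*_; :-_; con; _:=_) renaming (solve to solveᴿ)

  evalᴿ : Poly → Carrier → Carrier
  evalᴿ []      x = ι 0ℤ
  evalᴿ (a ∷ p) x = ι a +ᴿ x *ᴿ evalᴿ p x

  evalᴿ-⊞ : ∀ p q x → evalᴿ (p ⊞ q) x ≈ᴿ evalᴿ p x +ᴿ evalᴿ q x
  evalᴿ-⊞ []      q       x = solveᴿ 1 (λ q → q := con 0ℤ :+ q) ≈-refl (evalᴿ q x)
  evalᴿ-⊞ (a ∷ p) []      x = solveᴿ 1 (λ q → q := q :+ con 0ℤ) ≈-refl (evalᴿ (a ∷ p) x)
  evalᴿ-⊞ (a ∷ p) (b ∷ q) x = begin
    ι (a + b) +ᴿ x *ᴿ evalᴿ (p ⊞ q) x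
      ≈⟨ +-cong (+-homo a b) (*-congˡ (evalᴿ-⊞ p q x)) ⟩
    (ι a +ᴿ ι b) +ᴿ x *ᴿ (evalᴿ p x +ᴿ evalᴿ q x)
      ≈⟨ solveᴿ 5 (λ a b p q x → (a :+ b) :+ x :* (p :+ q) := (a :+ x :* p) :+ (b :+ x :* q)) ≈-refl (ι a) (ι b) (evalᴿ p x) (evalᴿ q x) x ⟩
    (ι a +ᴿ x *ᴿ evalᴿ p x) +ᴿ (ι b +ᴿ x *ᴿ evalᴿ q x) ∎

  evalᴿ-scale : ∀ c p x → evalᴿ (scale c p) x ≈ᴿ ι c *ᴿ evalᴿ p x
  evalᴿ-scale c []      x = solveᴿ 1 (λ c → con 0ℤ := c :* con 0ℤ) ≈-refl (ι c)
  evalᴿ-scale c (a ∷ p) x = begin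
    ι (c * a) +ᴿ x *ᴿ evalᴿ (scale c p) x
      ≈⟨ +-cong (*-homo c a) (*-congˡ (evalᴿ-scale c p x)) ⟩
    ι c *ᴿ ι a +ᴿ x *ᴿ (ι c *ᴿ evalᴿ p x)
      ≈⟨ solveᴿ 4 (λ c a x p → c :* a :+ x :* (c :* p) := c :* (a :+ x :* p)) ≈-refl (ι c) (ι a) x (evalᴿ p x) ⟩
    ι c *ᴿ (ι a +ᴿ x *ᴿ evalᴿ p x) ∎

  evalᴿ-⊠ : ∀ p q x → evalᴿ (p ⊠ q) x ≈ᴿ evalᴿ p x *ᴿ evalᴿ q x
  evalᴿ-⊠ []      q x = solveᴿ 1 (λ q → con 0ℤ := con 0ℤ :* q) ≈-refl (evalᴿ q x)
  evalᴿ-⊠ (a ∷ p) q x = begin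
    evalᴿ (scale a q ⊞ (0ℤ ∷ p ⊠ q)) x
      ≈⟨ evalᴿ-⊞ (scale a q) (0ℤ ∷ p ⊠ q) x ⟩
    evalᴿ (scale a q) x +ᴿ (ι 0ℤ +ᴿ x *ᴿ evalᴿ (p ⊠ q) x)
      ≈⟨ +-cong (evalᴿ-scale a q x) (+-congˡ (*-congˡ (evalᴿ-⊠ p q x))) ⟩
    ι a *ᴿ evalᴿ q x +ᴿ (ι 0ℤ +ᴿ x *ᴿ (evalᴿ p x *ᴿ evalᴿ q x))
      ≈⟨ solveᴿ 4 (λ a q x p → a :* q :+ (con 0ℤ :+ x :* (p :* q)) := (a :+ x :* p) :* q) ≈-refl (ι a) (evalᴿ q x) x (evalᴿ p x) ⟩
    (ι a +ᴿ x *ᴿ evalᴿ p x) *ᴿ evalᴿ q x ∎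

  evalᴿ-∘ : ∀ p q x → evalᴿ (p ∘ₚ q) x ≈ᴿ evalᴿ p (evalᴿ q x)
  evalᴿ-∘ []      q x = ≈-refl
  evalᴿ-∘ (a ∷ p) q x = begin
    evalᴿ ((a ∷ []) ⊞ q ⊠ (p ∘ₚ q)) x
      ≈⟨ evalᴿ-⊞ (a ∷ []) (q ⊠ (p ∘ₚ q)) x ⟩
    (ι a +ᴿ x *ᴿ ι 0ℤ) +ᴿ evalᴿ (q ⊠ (p ∘ₚ q)) x
      ≈⟨ +-cong (solveᴿ 2 (λ a x → a :+ x :* con 0ℤ := a) ≈-refl (ι a) x) (evalᴿ-⊠ q (p ∘ₚ q) x) ⟩
    ι a +ᴿ evalᴿ q x *ᴿ evalᴿ (p ∘ₚ q) x
      ≈⟨ +-congˡ (*-congˡ (evalᴿ-∘ p q x)) ⟩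
    ι a +ᴿ evalᴿ q x *ᴿ evalᴿ p (evalᴿ q x) ∎

  evalᴿ-IsZero : ∀ {p} x → IsZero p → evalᴿ p x ≈ᴿ ι 0ℤ
  evalᴿ-IsZero x All.[]         = ≈-refl
  evalᴿ-IsZero x (refl All.∷ z) = ≈-trans (+-congˡ (*-congˡ (evalᴿ-IsZero x z)))
    (solveᴿ 1 (λ x → con 0ℤ :+ x :* con 0ℤ := con 0ℤ) ≈-refl x)

  evalᴿ-quotientAt : ∀ m p x → evalᴿ p x +ᴿ -ᴿ evalᴿ p (ι m) ≈ᴿ (x +ᴿ -ᴿ ι m) *ᴿ evalᴿ (quotientAt m p) x
  evalᴿ-quotientAt m []      x = solveᴿ 2 (λ x m → con 0ℤ :+ :- con 0ℤ := (x :+ :- m) :* con 0ℤ) ≈-refl x (ι m)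
  evalᴿ-quotientAt m (a ∷ p) x = begin
    (ι a +ᴿ x *ᴿ P) +ᴿ -ᴿ (ι a +ᴿ ι m *ᴿ Pm)
      ≈⟨ solveᴿ 5 (λ a x P m Pm → (a :+ x :* P) :+ :- (a :+ m :* Pm) := (x :+ :- m) :* P :+ m :* (P :+ :- Pm)) ≈-refl (ι a) x P (ι m) Pm ⟩
    (x +ᴿ -ᴿ ι m) *ᴿ P +ᴿ ι m *ᴿ (P +ᴿ -ᴿ Pm)
      ≈⟨ +-congˡ (*-congˡ (evalᴿ-quotientAt m p x)) ⟩
    (x +ᴿ -ᴿ ι m) *ᴿ P +ᴿ ι m *ᴿ ((x +ᴿ -ᴿ ι m) *ᴿ Q)
      ≈⟨ solveᴿ 4 (λ x P m Q → (x :+ :- m) :* P :+ m :* ((x :+ :- m) :* Q) := (x :+ :- m) :* (P :+ m :* Q)) ≈-refl x P (ι m) Q ⟩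
    (x +ᴿ -ᴿ ι m) *ᴿ (P +ᴿ ι m *ᴿ Q)
      ≈⟨ *-congˡ (≈-trans (evalᴿ-⊞ p (scale m (quotientAt m p)) x) (+-congˡ (evalᴿ-scale m (quotientAt m p) x))) ⟨
    (x +ᴿ -ᴿ ι m) *ᴿ evalᴿ (quotientAt m (a ∷ p)) x ∎
    where
    P  = evalᴿ p x
    Pm = evalᴿ p (ι m)
    Q  = evalᴿ (quotientAt m p) x

  -- Writing P = a + x p and expanding p first produces the remainder by recursion, so it is
  -- integral although the usual formula divides by 2.
  taylor₂ : ∀ p x y → ∃ λ s → evalᴿ p y ≈ᴿ evalᴿ p x +ᴿ (y +ᴿ -ᴿ x) *ᴿ evalᴿ (derivative p) x +ᴿ (y +ᴿ -ᴿ x) *ᴿ (y +ᴿ -ᴿ x) *ᴿ s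
  taylor₂ []      x y = ι 0ℤ , solveᴿ 2 (λ x y → con 0ℤ := con 0ℤ :+ (y :+ :- x) :* con 0ℤ :+ (y :+ :- x) :* (y :+ :- x) :* con 0ℤ) ≈-refl x y
  taylor₂ (a ∷ p) x y with taylor₂ p x y
  ... | s , eq = P′ +ᴿ y *ᴿ s , (begin
    ι a +ᴿ y *ᴿ evalᴿ p y
      ≈⟨ +-congˡ (*-congˡ eq) ⟩
    ι a +ᴿ y *ᴿ (P +ᴿ (y +ᴿ -ᴿ x) *ᴿ P′ +ᴿ (y +ᴿ -ᴿ x) *ᴿ (y +ᴿ -ᴿ x) *ᴿ s)
      ≈⟨ solveᴿ 6 (λ a x y P P′ s →
           a :+ y :* (P :+ (y :+ :- x) :* P′ :+ (y :+ :- x) :* (y :+ :- x) :* s) :=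
           (a :+ x :* P) :+ (y :+ :- x) :* (P :+ (con 0ℤ :+ x :* P′)) :+ (y :+ :- x) :* (y :+ :- x) :* (P′ :+ y :* s)) ≈-refl (ι a) x y P P′ s ⟩
    (ι a +ᴿ x *ᴿ P) +ᴿ (y +ᴿ -ᴿ x) *ᴿ (P +ᴿ (ι 0ℤ +ᴿ x *ᴿ P′)) +ᴿ (y +ᴿ -ᴿ x) *ᴿ (y +ᴿ -ᴿ x) *ᴿ (P′ +ᴿ y *ᴿ s)
      ≈⟨ +-congʳ (+-congˡ (*-congˡ (evalᴿ-⊞ p (0ℤ ∷ derivative p) x))) ⟨
    (ι a +ᴿ x *ᴿ P) +ᴿ (y +ᴿ -ᴿ x) *ᴿ evalᴿ (derivative (a ∷ p)) x +ᴿ (y +ᴿ -ᴿ x) *ᴿ (y +ᴿ -ᴿ x) *ᴿ (P′ +ᴿ y *ᴿ s) ∎)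
    where
    P  = evalᴿ p x
    P′ = evalᴿ (derivative p) x

ℤ-algebra : ℤ-Algebra
ℤ-algebra = record { commutativeRing = +-*-commutativeRing ; structureMap = record
  { ⟦_⟧ = λ a → a ; +-homo = λ _ _ → refl ; *-homo = λ _ _ → refl ; -‿homo = λ _ → refl ; 0-homo = refl ; 1-homo = refl } }

private module E = Evaluation ℤ-algebra

eval≡evalᴿ : ∀ p x → eval p x ≡ E.evalᴿ p x
eval≡evalᴿ []      x = refl
eval≡evalᴿ (a ∷ p) x = cong (λ z → a + x * z) (eval≡evalᴿ p x)

eval-⊞ : ∀ p q x → eval (p ⊞ q) x ≡ eval p x + eval q x
eval-⊞ p q x rewrite eval≡evalᴿ (p ⊞ q) x | eval≡evalᴿ p x | eval≡evalᴿ q x = E.evalᴿ-⊞ p q x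

eval-scale : ∀ c p x → eval (scale c p) x ≡ c * eval p x
eval-scale c p x rewrite eval≡evalᴿ (scale c p) x | eval≡evalᴿ p x = E.evalᴿ-scale c p x

eval-⊠ : ∀ p q x → eval (p ⊠ q) x ≡ eval p x * eval q x
eval-⊠ p q x rewrite eval≡evalᴿ (p ⊠ q) x | eval≡evalᴿ p x | eval≡evalᴿ q x = E.evalᴿ-⊠ p q x

eval-∘ : ∀ p q x → eval (p ∘ₚ q) x ≡ eval p (eval q x)
eval-∘ p q x rewrite eval≡evalᴿ (p ∘ₚ q) x | eval≡evalᴿ q x | eval≡evalᴿ p (E.evalᴿ q x) = E.evalᴿ-∘ p q x

eval-IsZero : ∀ {p} x → IsZero p → eval p x ≡ 0ℤ
eval-IsZero {p} x z = trans (eval≡evalᴿ p x) (E.evalᴿ-IsZero x z)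

eval-quotientAt : ∀ m p x → eval p x + - eval p m ≡ (x + - m) * eval (quotientAt m p) x
eval-quotientAt m p x rewrite eval≡evalᴿ p x | eval≡evalᴿ p m | eval≡evalᴿ (quotientAt m p) x = E.evalᴿ-quotientAt m p x

eval-≋ : ∀ {q x y} p → x ≋ y [ q ] → eval p x ≋ eval p y [ q ]
eval-≋ []      x≋y = ≋-refl
eval-≋ (a ∷ p) x≋y = ≋-+ˡ a (≋-* x≋y (eval-≋ p x≋y))

-- Polynomial identities from integer values

infix 4 _≐_

-- Coefficient lists may differ in trailing zeros, so polynomials are compared through their values
-- on ℤ.
_≐_ : Poly → Poly → Set
p ≐ q = ∀ x → eval p x ≡ eval q x

*-≢0 : ∀ a b → a ≢ 0ℤ → b ≢ 0ℤ → a * b ≢ 0ℤ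
*-≢0 a b a≢0 b≢0 ab≡0 = [ a≢0 , b≢0 ]′ (i*j≡0⇒i≡0∨j≡0 a ab≡0)

odd≢0 : ∀ y → 1ℤ + + 2 * y ≢ 0ℤ
odd≢0 y eq with ℕ.m*n≡1⇒m≡1 2 ∣ - y ∣ (trans (sym (ℤ.abs-* (+ 2) (- y))) (cong ∣_∣ 2*-y≡1))
  where
  2*-y≡1 : + 2 * - y ≡ 1ℤ
  2*-y≡1 = begin
    + 2 * - y                ≡⟨ solve (y ∷ []) ⟩
    1ℤ + - (1ℤ + + 2 * y)    ≡⟨ cong (λ z → 1ℤ + - z) eq ⟩
    1ℤ                       ∎
    where open ≡-Reasoning
... | ()

-- If the constant term is a ≠ 0 then P(2an) = a (1 + 2 n …) is a times an odd number.
zero-or-nonroot : ∀ p → IsZero p ⊎ (∀ n → n ≢ 0ℤ → ∃ λ t → t ≢ 0ℤ × eval p (n * t) ≢ 0ℤ)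
zero-or-nonroot [] = inj₁ All.[]
zero-or-nonroot (a ∷ p) with a ℤ.≟ 0ℤ
... | no a≢0 = inj₂ λ n n≢0 → + 2 * a , *-≢0 (+ 2) a (λ ()) a≢0 ,
      λ e → *-≢0 a _ a≢0 (odd≢0 (n * eval p (n * (+ 2 * a)))) (trans (lemma a n (eval p (n * (+ 2 * a)))) e)
  where
  lemma : ∀ a n e → a * (1ℤ + + 2 * (n * e)) ≡ a + n * (+ 2 * a) * e
  lemma = solve-∀
... | yes refl with zero-or-nonroot p
...   | inj₁ z = inj₁ (refl All.∷ z)
-- Here P = x p, and the nonroot `n t` of p serves because it is itself nonzero; t ≠ 0 is carried
-- along for this.
...   | inj₂ f = inj₂ λ n n≢0 → let (t , t≢0 , e≢0) = f n n≢0 in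
        t , t≢0 , λ e → *-≢0 _ _ (*-≢0 n t n≢0 t≢0) e≢0 (trans (sym (+-identityˡ _)) e)

vanishing⇒IsZero : ∀ p → (∀ x → eval p x ≡ 0ℤ) → IsZero p
vanishing⇒IsZero p v with zero-or-nonroot p
... | inj₁ z = z
... | inj₂ f = let (t , _ , e≢0) = f 1ℤ (λ ()) in contradiction (v (1ℤ * t)) e≢0

≐⇒IsZero : ∀ p q → p ≐ q → IsZero (p ⊞ scale (- 1ℤ) q)
≐⇒IsZero p q p≐q = vanishing⇒IsZero _ λ x → begin
  eval (p ⊞ scale (- 1ℤ) q) x         ≡⟨ eval-⊞ p _ x ⟩
  eval p x + eval (scale (- 1ℤ) q) x  ≡⟨ cong₂ _+_ (p≐q x) (eval-scale (- 1ℤ) q x) ⟩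
  eval q x + - 1ℤ * eval q x          ≡⟨ lemma (eval q x) ⟩
  0ℤ                                  ∎
  where
  open ≡-Reasoning
  lemma : ∀ a → a + - 1ℤ * a ≡ 0ℤ
  lemma = solve-∀

module _ (A : ℤ-Algebra) where
  open Evaluation A
  open ≈ᴿ-Reasoning

  -- Integer values determine the coefficients, so an identity checked on ℤ transfers to every
  -- ℤ-algebra.
  evalᴿ-≐ : ∀ p q → p ≐ q → ∀ x → evalᴿ p x ≈ᴿ evalᴿ q x
  evalᴿ-≐ p q p≐q x = begin
    P                                ≈⟨ solveᴿ 2 (λ P Q → P := P :+ con (- 1ℤ) :* Q :+ Q) ≈-refl P Q ⟩
    P +ᴿ ι (- 1ℤ) *ᴿ Q +ᴿ Q          ≈⟨ +-congʳ (≈-trans (evalᴿ-⊞ p _ x) (+-congˡ (evalᴿ-scale (- 1ℤ) q x))) ⟨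
    evalᴿ (p ⊞ scale (- 1ℤ) q) x +ᴿ Q ≈⟨ +-congʳ (evalᴿ-IsZero x (≐⇒IsZero p q p≐q)) ⟩
    ι 0ℤ +ᴿ Q                        ≈⟨ solveᴿ 1 (λ Q → con 0ℤ :+ Q := Q) ≈-refl Q ⟩
    Q                                ∎
    where
    P = evalᴿ p x
    Q = evalᴿ q x

-- Coefficients and degrees

coeff-⊞ : ∀ p q i → coeff (p ⊞ q) i ≡ coeff p i + coeff q i
coeff-⊞ []      q       i       = sym (+-identityˡ _)
coeff-⊞ (a ∷ p) []      i       = sym (+-identityʳ _)
coeff-⊞ (a ∷ p) (b ∷ q) zero    = refl
coeff-⊞ (a ∷ p) (b ∷ q) (suc i) = coeff-⊞ p q i

coeff-scale : ∀ c p i → coeff (scale c p) i ≡ c * coeff p i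
coeff-scale c []      i       = sym (*-zeroʳ c)
coeff-scale c (a ∷ p) zero    = refl
coeff-scale c (a ∷ p) (suc i) = coeff-scale c p i

coeff-IsZero : ∀ {p} → IsZero p → ∀ i → coeff p i ≡ 0ℤ
coeff-IsZero All.[]    i       = refl
coeff-IsZero (e All.∷ z) zero    = e
coeff-IsZero (e All.∷ z) (suc i) = coeff-IsZero z i

coeff-≥length : ∀ p {i} → length p ℕ.≤ i → coeff p i ≡ 0ℤ
coeff-≥length []      _         = refl
coeff-≥length (a ∷ p) (s≤s len) = coeff-≥length p len

coeff-last : ∀ l z → coeff (l ∷ʳ z) (length l) ≡ z
coeff-last []      z = refl
coeff-last (a ∷ l) z = coeff-last l z

length-∷ʳ : ∀ (l : Poly) z → length (l ∷ʳ z) ≡ suc (length l)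
length-∷ʳ []      z = refl
length-∷ʳ (a ∷ l) z = cong suc (length-∷ʳ l z)

coeff-≐ : ∀ p q → p ≐ q → ∀ i → coeff p i ≡ coeff q i
coeff-≐ p q p≐q i = begin
  coeff p i                                         ≡⟨ lemma (coeff p i) (coeff q i) ⟩
  coeff p i + - 1ℤ * coeff q i + coeff q i          ≡⟨ cong (_+ coeff q i) (trans (coeff-⊞ p _ i) (cong (λ z → coeff p i + z) (coeff-scale (- 1ℤ) q i))) ⟨
  coeff (p ⊞ scale (- 1ℤ) q) i + coeff q i          ≡⟨ cong (_+ coeff q i) (coeff-IsZero (≐⇒IsZero p q p≐q) i) ⟩
  0ℤ + coeff q i                                    ≡⟨ +-identityˡ _ ⟩
  coeff q i                                         ∎
  where
  open ≡-Reasoning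
  lemma : ∀ a b → a ≡ a + - 1ℤ * b + b
  lemma = solve-∀

coeff-derivative : ∀ p i → coeff (derivative p) i ≡ + suc i * coeff p (suc i)
coeff-derivative []      i = sym (*-zeroʳ (+ suc i))
coeff-derivative (a ∷ p) zero =
  trans (coeff-⊞ p _ 0) (trans (+-identityʳ _) (sym (ℤ.*-identityˡ _)))
coeff-derivative (a ∷ p) (suc i) = begin
  coeff (p ⊞ (0ℤ ∷ derivative p)) (suc i)            ≡⟨ coeff-⊞ p _ (suc i) ⟩
  coeff p (suc i) + coeff (derivative p) i           ≡⟨ cong (λ z → coeff p (suc i) + z) (coeff-derivative p i) ⟩
  coeff p (suc i) + + suc i * coeff p (suc i)        ≡⟨ lemma (coeff p (suc i)) (+ suc i) ⟩
  (1ℤ + + suc i) * coeff p (suc i)                   ∎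
  where
  open ≡-Reasoning
  lemma : ∀ c n → c + n * c ≡ (1ℤ + n) * c
  lemma = solve-∀

length-⊞ : ∀ {k} p q → length p ℕ.≤ k → length q ℕ.≤ k → length (p ⊞ q) ℕ.≤ k
length-⊞ []      q       _       h       = h
length-⊞ (a ∷ p) []      h       _       = h
length-⊞ (a ∷ p) (b ∷ q) (s≤s h) (s≤s k) = s≤s (length-⊞ p q h k)

nonzero-coeff⇒<length : ∀ p {i} → coeff p i ≢ 0ℤ → i ℕ.< length p
nonzero-coeff⇒<length p {i} c≢0 with i ℕ.<? length p
... | yes i<len = i<len
... | no  i≮len = contradiction (coeff-≥length p (ℕ.≮⇒≥ i≮len)) c≢0

-- Normal form for all degree arguments: `l ∷ʳ z` with z ≠ 0 has degree `length l` and leading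
-- coefficient z.
trim : ∀ p → IsZero p ⊎ ∃ λ l → ∃ λ z → z ≢ 0ℤ × length l ℕ.< length p × p ≐ l ∷ʳ z
trim [] = inj₁ All.[]
trim (a ∷ p) with trim p
... | inj₂ (l , z , z≢0 , len , p≐) = inj₂ (a ∷ l , z , z≢0 , s≤s len , λ x → cong (λ e → a + x * e) (p≐ x))
... | inj₁ p≡0 with a ℤ.≟ 0ℤ
...   | yes a≡0 = inj₁ (a≡0 All.∷ p≡0)
...   | no  a≢0 = inj₂ ([] , a , a≢0 , s≤s z≤n , λ x → cong (λ e → a + x * e) (eval-IsZero x p≡0))

coeff-⊠-last : ∀ l z m w → coeff ((l ∷ʳ z) ⊠ (m ∷ʳ w)) (length l ℕ.+ length m) ≡ z * w
coeff-⊠-last [] z m w = begin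
  coeff (scale z (m ∷ʳ w) ⊞ (0ℤ ∷ [])) (length m)                       ≡⟨ coeff-⊞ (scale z (m ∷ʳ w)) _ (length m) ⟩
  coeff (scale z (m ∷ʳ w)) (length m) + coeff (0ℤ ∷ []) (length m)       ≡⟨ cong₂ _+_ (coeff-scale z (m ∷ʳ w) (length m)) (coeff-IsZero (refl All.∷ All.[]) (length m)) ⟩
  z * coeff (m ∷ʳ w) (length m) + 0ℤ                                    ≡⟨ trans (+-identityʳ _) (cong (z *_) (coeff-last m w)) ⟩
  z * w                                                                 ∎
  where open ≡-Reasoning
coeff-⊠-last (a ∷ l) z m w = begin
  coeff (scale a q ⊞ (0ℤ ∷ (l ∷ʳ z) ⊠ q)) (suc k)       ≡⟨ coeff-⊞ (scale a q) _ (suc k) ⟩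
  coeff (scale a q) (suc k) + coeff ((l ∷ʳ z) ⊠ q) k    ≡⟨ cong₂ _+_ (coeff-scale a q (suc k)) (coeff-⊠-last l z m w) ⟩
  a * coeff q (suc k) + z * w                           ≡⟨ cong (λ e → a * e + z * w) (coeff-≥length q (subst (ℕ._≤ suc k) (sym (length-∷ʳ m w)) (s≤s (ℕ.m≤n+m _ _)))) ⟩
  a * 0ℤ + z * w                                        ≡⟨ trans (cong (_+ z * w) (*-zeroʳ a)) (+-identityˡ _) ⟩
  z * w                                                 ∎
  where
  open ≡-Reasoning
  q = m ∷ʳ w
  k = length l ℕ.+ length m

eval-∷ʳ : ∀ l z x → eval (l ∷ʳ z) x ≡ eval l x + z * x ^ length l
eval-∷ʳ [] z x = lemma z x
  where
  lemma : ∀ z x → z + x * 0ℤ ≡ 0ℤ + z * 1ℤ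
  lemma = solve-∀
eval-∷ʳ (a ∷ l) z x = begin
  a + x * eval (l ∷ʳ z) x                     ≡⟨ cong (λ e → a + x * e) (eval-∷ʳ l z x) ⟩
  a + x * (eval l x + z * x ^ length l)       ≡⟨ lemma a x (eval l x) z (x ^ length l) ⟩
  a + x * eval l x + z * (x * x ^ length l)   ∎
  where
  open ≡-Reasoning
  lemma : ∀ a x e z y → a + x * (e + z * y) ≡ a + x * e + z * (x * y)
  lemma = solve-∀

-- Greatest common divisors over ℚ, with denominators cleared

unsnoc : ∀ {k} (l : Poly) → length l ≡ suc k → ∃ λ m → ∃ λ z → l ≡ m ∷ʳ z × length m ≡ k
unsnoc (a ∷ [])    refl = [] , a , refl , refl
unsnoc (a ∷ b ∷ l) refl with unsnoc (b ∷ l) refl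
... | m , z , eq , len = a ∷ m , z , cong (a ∷_) eq , cong suc len

-- Horner's scheme: if n p = q G + r for the tail p, then n (a + x p) = (x q) G + (n a + x r).
-- Whenever the new remainder reaches the degree of G, everything is multiplied by the leading
-- coefficient z, so n is a power of z.
pseudoDivision : ∀ g z → z ≢ 0ℤ → ∀ f → ∃ λ n → ∃ λ q → ∃ λ r → n ≢ 0ℤ × length r ℕ.≤ length g ×
  (∀ x → n * eval f x ≡ eval q x * eval (g ∷ʳ z) x + eval r x)
pseudoDivision g z z≢0 [] = 1ℤ , [] , [] , (λ ()) , z≤n , λ x → refl
pseudoDivision g z z≢0 (a ∷ f) with pseudoDivision g z z≢0 f
... | n , q , r , n≢0 , len , eq with suc (length r) ℕ.≤? length g
...   | yes len′ = n , 0ℤ ∷ q , n * a ∷ r , n≢0 , len′ , λ x →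
          trans (lemma₁ n a x (eval f x)) (trans (cong (λ e → n * a + x * e) (eq x)) (lemma₂ (n * a) x (eval q x) (eval (g ∷ʳ z) x) (eval r x)))
  where
  lemma₁ : ∀ n a x f → n * (a + x * f) ≡ n * a + x * (n * f)
  lemma₁ = solve-∀
  lemma₂ : ∀ b x q g r → b + x * (q * g + r) ≡ (0ℤ + x * q) * g + (b + x * r)
  lemma₂ = solve-∀
-- Now `r` has exactly `length g` entries, so the top entry w of `n * a ∷ r` sits in the degree of
-- the divisor; z times this remainder minus w times the divisor loses the top term.
...   | no len′ with unsnoc (n * a ∷ r) (cong suc (ℕ.≤-antisym len (ℕ.≮⇒≥ len′)))
...     | m , w , eqm , lenm = z * n , w ∷ scale z q , scale z m ⊞ scale (- w) g , *-≢0 z n z≢0 n≢0 ,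
          length-⊞ (scale z m) _ (ℕ.≤-reflexive (trans (length-map _ m) lenm)) (ℕ.≤-reflexive (length-map _ g)) , λ x → begin
  z * n * (a + x * eval f x)                                         ≡⟨ lemma₁ z n a x (eval f x) ⟩
  z * (n * a + x * (n * eval f x))                                   ≡⟨ cong (λ e → z * (n * a + x * e)) (eq x) ⟩
  z * (n * a + x * (eval q x * eval (g ∷ʳ z) x + eval r x))          ≡⟨ lemma₂ z (n * a) x (eval q x) (eval (g ∷ʳ z) x) (eval r x) ⟩
  x * (z * eval q x) * eval (g ∷ʳ z) x + z * eval (n * a ∷ r) x      ≡⟨ cong (λ l → x * (z * eval q x) * eval (g ∷ʳ z) x + z * eval l x) eqm ⟩
  x * (z * eval q x) * eval (g ∷ʳ z) x + z * eval (m ∷ʳ w) x         ≡⟨ cong₂ (λ G M → x * (z * eval q x) * G + z * M) (eval-∷ʳ g z x) (trans (eval-∷ʳ m w x) (cong (λ k → eval m x + w * x ^ k) lenm)) ⟩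
  x * (z * eval q x) * (eval g x + z * x ^ length g) + z * (eval m x + w * x ^ length g)
    ≡⟨ lemma₃ x z (eval q x) (eval g x) (x ^ length g) (eval m x) w ⟩
  (w + x * (z * eval q x)) * (eval g x + z * x ^ length g) + (z * eval m x + - w * eval g x)
    ≡⟨ cong₂ (λ Q R → (w + x * Q) * (eval g x + z * x ^ length g) + R) (eval-scale z q x) (trans (eval-⊞ (scale z m) _ x) (cong₂ _+_ (eval-scale z m x) (eval-scale (- w) g x))) ⟨
  (w + x * eval (scale z q) x) * (eval g x + z * x ^ length g) + eval (scale z m ⊞ scale (- w) g) x
    ≡⟨ cong (λ G → (w + x * eval (scale z q) x) * G + eval (scale z m ⊞ scale (- w) g) x) (eval-∷ʳ g z x) ⟨
  (w + x * eval (scale z q) x) * eval (g ∷ʳ z) x + eval (scale z m ⊞ scale (- w) g) x ∎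
  where
  open ≡-Reasoning
  lemma₁ : ∀ z n a x f → z * n * (a + x * f) ≡ z * (n * a + x * (n * f))
  lemma₁ = solve-∀
  lemma₂ : ∀ z b x q g r → z * (b + x * (q * g + r)) ≡ x * (z * q) * g + z * (b + x * r)
  lemma₂ = solve-∀
  lemma₃ : ∀ x z q g y m w → x * (z * q) * (g + z * y) + z * (m + w * y) ≡ (w + x * (z * q)) * (g + z * y) + (z * m + - w * g)
  lemma₃ = solve-∀

-- `body ∷ʳ lead` is a gcd over ℚ, scaled so that its Bézout combination is integral; the factor `n`
-- clears the denominators of the two cofactors.
record BézoutGCD (f g : Poly) (bound : ℕ) : Set where
  field
    body           : Poly
    lead           : ℤ
    lead≢0         : lead ≢ 0ℤ
    length-body    : length body ℕ.≤ bound
    a b u v        : Poly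
    n              : ℤ
    n≢0            : n ≢ 0ℤ
    combination    : ∀ x → eval (body ∷ʳ lead) x ≡ eval a x * eval f x + eval b x * eval g x
    divides-f      : ∀ x → n * eval f x ≡ eval u x * eval (body ∷ʳ lead) x
    divides-g      : ∀ x → n * eval g x ≡ eval v x * eval (body ∷ʳ lead) x

-- Euclid's algorithm: over ℚ, the divisor and the pseudo-remainder n f - q (g ∷ʳ z) have the same
-- gcd as f and the divisor. `k` bounds the degree of the divisor and drops with each call.
bézoutGCD : ∀ k f g z → z ≢ 0ℤ → length g ℕ.< k → BézoutGCD f (g ∷ʳ z) (length g)
bézoutGCD (suc k) f g z z≢0 (s≤s len) with pseudoDivision g z z≢0 f
... | n , q , r , n≢0 , lenr , eq with trim r
...   | inj₁ r≡0 = record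
          { body = g ; lead = z ; lead≢0 = z≢0 ; length-body = ℕ.≤-refl
          ; a = [] ; b = 1ℤ ∷ [] ; u = q ; v = n ∷ [] ; n = n ; n≢0 = n≢0
          ; combination = λ x → lemma₁ (eval f x) (eval (g ∷ʳ z) x) x
          ; divides-f = λ x → trans (eq x) (trans (cong (λ e → eval q x * eval (g ∷ʳ z) x + e) (eval-IsZero x r≡0)) (+-identityʳ _))
          ; divides-g = λ x → lemma₂ n (eval (g ∷ʳ z) x) x
          }
  where
  lemma₁ : ∀ f g x → g ≡ 0ℤ * f + (1ℤ + x * 0ℤ) * g
  lemma₁ = solve-∀
  lemma₂ : ∀ n g x → n * g ≡ (n + x * 0ℤ) * g
  lemma₂ = solve-∀
...   | inj₂ (s , w , w≢0 , lens , r≐) with bézoutGCD k (g ∷ʳ z) s w w≢0 (ℕ.<-≤-trans lens (ℕ.≤-trans lenr len))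
...     | h = record
          { body = H.body ; lead = H.lead ; lead≢0 = H.lead≢0
          ; length-body = ℕ.≤-trans H.length-body (ℕ.≤-trans (ℕ.<⇒≤ lens) lenr)
          ; a = scale n H.b ; b = H.a ⊞ scale (- 1ℤ) (q ⊠ H.b) ; u = q ⊠ H.u ⊞ H.v ; v = scale n H.u
          ; n = H.n * n ; n≢0 = *-≢0 H.n n H.n≢0 n≢0
          ; combination = combination ; divides-f = divides-f ; divides-g = divides-g
          }
  where
  module H = BézoutGCD h
  G = λ x → eval (g ∷ʳ z) x
  D = λ x → eval (H.body ∷ʳ H.lead) x
  open ≡-Reasoning
  remainder : ∀ x → eval (s ∷ʳ w) x ≡ n * eval f x + - 1ℤ * (eval q x * G x)
  remainder x = begin
    eval (s ∷ʳ w) x                                          ≡⟨ r≐ x ⟨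
    eval r x                                                 ≡⟨ lemma (eval r x) (eval q x) (G x) ⟩
    eval q x * G x + eval r x + - 1ℤ * (eval q x * G x)      ≡⟨ cong (_+ - 1ℤ * (eval q x * G x)) (eq x) ⟨
    n * eval f x + - 1ℤ * (eval q x * G x)                   ∎
    where
    lemma : ∀ r q g → r ≡ q * g + r + - 1ℤ * (q * g)
    lemma = solve-∀
  combination : ∀ x → D x ≡ eval (scale n H.b) x * eval f x + eval (H.a ⊞ scale (- 1ℤ) (q ⊠ H.b)) x * G x
  combination x = begin
    D x                                                                   ≡⟨ H.combination x ⟩
    eval H.a x * G x + eval H.b x * eval (s ∷ʳ w) x                        ≡⟨ cong (λ e → eval H.a x * G x + eval H.b x * e) (remainder x) ⟩
    eval H.a x * G x + eval H.b x * (n * eval f x + - 1ℤ * (eval q x * G x)) ≡⟨ lemma (eval H.a x) (G x) (eval H.b x) n (eval f x) (eval q x) ⟩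
    n * eval H.b x * eval f x + (eval H.a x + - 1ℤ * (eval q x * eval H.b x)) * G x
      ≡⟨ cong₂ (λ A B → A * eval f x + B * G x) (eval-scale n H.b x)
           (trans (eval-⊞ H.a _ x) (cong (λ e → eval H.a x + e) (trans (eval-scale (- 1ℤ) (q ⊠ H.b) x) (cong (- 1ℤ *_) (eval-⊠ q H.b x))))) ⟨
    eval (scale n H.b) x * eval f x + eval (H.a ⊞ scale (- 1ℤ) (q ⊠ H.b)) x * G x ∎
    where
    lemma : ∀ a g b n f q → a * g + b * (n * f + - 1ℤ * (q * g)) ≡ n * b * f + (a + - 1ℤ * (q * b)) * g
    lemma = solve-∀
  divides-f : ∀ x → H.n * n * eval f x ≡ eval (q ⊠ H.u ⊞ H.v) x * D x
  divides-f x = begin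
    H.n * n * eval f x                                       ≡⟨ lemma₁ H.n n (eval f x) (eval q x) (G x) ⟩
    Q * (H.n * G x) + H.n * (n * eval f x + - 1ℤ * (Q * G x)) ≡⟨ cong (λ e → Q * (H.n * G x) + H.n * e) (remainder x) ⟨
    Q * (H.n * G x) + H.n * eval (s ∷ʳ w) x              ≡⟨ cong₂ (λ A B → Q * A + B) (H.divides-f x) (H.divides-g x) ⟩
    Q * (eval H.u x * D x) + eval H.v x * D x            ≡⟨ lemma₂ Q (eval H.u x) (D x) (eval H.v x) ⟩
    (Q * eval H.u x + eval H.v x) * D x                  ≡⟨ cong (_* D x) (trans (eval-⊞ (q ⊠ H.u) H.v x) (cong (_+ eval H.v x) (eval-⊠ q H.u x))) ⟨
    eval (q ⊠ H.u ⊞ H.v) x * D x                             ∎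
    where
    Q = eval q x
    lemma₁ : ∀ m n f q g → m * n * f ≡ q * (m * g) + m * (n * f + - 1ℤ * (q * g))
    lemma₁ = solve-∀
    lemma₂ : ∀ q u d v → q * (u * d) + v * d ≡ (q * u + v) * d
    lemma₂ = solve-∀
  divides-g : ∀ x → H.n * n * G x ≡ eval (scale n H.u) x * D x
  divides-g x = begin
    H.n * n * G x                      ≡⟨ lemma H.n n (G x) ⟩
    n * (H.n * G x)                    ≡⟨ cong (n *_) (H.divides-f x) ⟩
    n * (eval H.u x * D x)             ≡⟨ ℤ.*-assoc n (eval H.u x) (D x) ⟨
    n * eval H.u x * D x               ≡⟨ cong (_* D x) (eval-scale n H.u x) ⟨
    eval (scale n H.u) x * D x         ∎
    where
    lemma : ∀ m n g → m * n * g ≡ n * (m * g)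
    lemma = solve-∀

-- Linear forms and Gaussian elimination

dot : List ℤ → (ℕ → ℤ) → ℤ
dot []      s = 0ℤ
dot (a ∷ c) s = a * s 0 + dot c (s ∘ suc)

dot-cong : ∀ {q} c {s t : ℕ → ℤ} → (∀ i → s i ≋ t i [ q ]) → dot c s ≋ dot c t [ q ]
dot-cong []      eq = ≋-refl
dot-cong (a ∷ c) eq = ≋-+ (≋-*ˡ a (eq 0)) (dot-cong c (eq ∘ suc))

dot-linear : ∀ c a (s : ℕ → ℤ) b t → dot c (λ i → a * s i + b * t i) ≡ a * dot c s + b * dot c t
dot-linear []      a s b t = lemma a b
  where
  lemma : ∀ a b → 0ℤ ≡ a * 0ℤ + b * 0ℤ
  lemma = solve-∀
dot-linear (d ∷ c) a s b t = begin
  d * (a * s 0 + b * t 0) + dot c (λ i → a * s (suc i) + b * t (suc i))        ≡⟨ cong (λ e → d * (a * s 0 + b * t 0) + e) (dot-linear c a (s ∘ suc) b (t ∘ suc)) ⟩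
  d * (a * s 0 + b * t 0) + (a * dot c (s ∘ suc) + b * dot c (t ∘ suc))        ≡⟨ lemma d a (s 0) b (t 0) (dot c (s ∘ suc)) (dot c (t ∘ suc)) ⟩
  a * (d * s 0 + dot c (s ∘ suc)) + b * (d * t 0 + dot c (t ∘ suc))            ∎
  where
  open ≡-Reasoning
  lemma : ∀ d a s b t S T → d * (a * s + b * t) + (a * S + b * T) ≡ a * (d * s + S) + b * (d * t + T)
  lemma = solve-∀

dot-scale : ∀ a c s → dot (scale a c) s ≡ a * dot c s
dot-scale a []      s = sym (*-zeroʳ a)
dot-scale a (d ∷ c) s = trans (cong (λ e → a * d * s 0 + e) (dot-scale a c (s ∘ suc))) (lemma a d (s 0) (dot c (s ∘ suc)))
  where
  lemma : ∀ a d s S → a * d * s + a * S ≡ a * (d * s + S)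
  lemma = solve-∀

dot-⊞ : ∀ p q s → dot (p ⊞ q) s ≡ dot p s + dot q s
dot-⊞ []      q       s = sym (+-identityˡ _)
dot-⊞ (a ∷ p) []      s = sym (+-identityʳ _)
dot-⊞ (a ∷ p) (b ∷ q) s = trans (cong (λ e → (a + b) * s 0 + e) (dot-⊞ p q (s ∘ suc))) (lemma a b (s 0) (dot p (s ∘ suc)) (dot q (s ∘ suc)))
  where
  lemma : ∀ a b s p q → (a + b) * s + (p + q) ≡ a * s + p + (b * s + q)
  lemma = solve-∀

dot-zeros : ∀ n s → dot (replicate n 0ℤ) s ≡ 0ℤ
dot-zeros zero    s = refl
dot-zeros (suc n) s = trans (+-identityˡ _) (dot-zeros n (s ∘ suc))

dot-vanishing : ∀ c s → (∀ i → i ℕ.< length c → s i ≡ 0ℤ) → dot c s ≡ 0ℤ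
dot-vanishing []      s v = refl
dot-vanishing (a ∷ c) s v = trans (cong₂ (λ x y → a * x + y) (v 0 (s≤s z≤n)) (dot-vanishing c (s ∘ suc) (λ i i< → v (suc i) (s≤s i<)))) (trans (+-identityʳ _) (*-zeroʳ a))

dot-∷ʳ : ∀ l z s → dot (l ∷ʳ z) s ≡ dot l s + z * s (length l)
dot-∷ʳ []      z s = lemma (z * s 0)
  where
  lemma : ∀ y → y + 0ℤ ≡ 0ℤ + y
  lemma = solve-∀
dot-∷ʳ (a ∷ l) z s = trans (cong (λ e → a * s 0 + e) (dot-∷ʳ l z (s ∘ suc))) (sym (ℤ.+-assoc (a * s 0) (dot l (s ∘ suc)) (z * s (suc (length l)))))

IsZero-scale⁻ : ∀ a c → a ≢ 0ℤ → IsZero (scale a c) → IsZero c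
IsZero-scale⁻ a []      a≢0 _            = All.[]
IsZero-scale⁻ a (d ∷ c) a≢0 (e All.∷ z) =
  [ (λ a≡0 → contradiction a≡0 a≢0) , (λ d≡0 → d≡0) ]′ (i*j≡0⇒i≡0∨j≡0 a e) All.∷ IsZero-scale⁻ a c a≢0 z

-- Pivot search. The last component puts the pivot back for an arbitrary predicate, so that its
-- position need not be tracked.
pick : ∀ {X : Set} (f : X → ℤ) E → All (λ x → f x ≡ 0ℤ) E ⊎
  ∃ λ x → ∃ λ E′ → f x ≢ 0ℤ × length E ≡ suc (length E′) × (∀ {P : X → Set} → P x → All P E′ → All P E)
pick f [] = inj₁ All.[]
pick f (y ∷ E) with f y ℤ.≟ 0ℤ
... | no  y≢0 = inj₂ (y , E , y≢0 , refl , All._∷_)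
... | yes y≡0 with pick f E
...   | inj₁ z = inj₁ (y≡0 All.∷ z)
...   | inj₂ (x , E′ , x≢0 , len , all) = inj₂ (x , y ∷ E′ , x≢0 , cong suc len , λ { px (py All.∷ pE) → py All.∷ all px pE })

-- Equations are elements of a set closed under linear combination, so that a combination found by
-- elimination is again such an element; later these are functionals on an algebra.
record Functionals : Set₁ where
  field
    X      : Set
    values : X → ℕ → ℤ
    combine : ℤ → X → ℤ → X → X
    values-combine : ∀ a x b y i → values (combine a x b y) i ≡ a * values x i + b * values y i

-- When `values x i` is x(wⁱ), this is a relation among 1, w, ..., wⁿ as far as the functionals in E
-- can see.
Relation : (V : Functionals) → List (Functionals.X V) → ℕ → Set
Relation V E n = ∃ λ c → length c ≡ suc n × ¬ IsZero c × All (λ x → dot c (values x) ≡ 0ℤ) E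
  where open Functionals V

-- In the same reading, a certificate that wⁿ is not a rational combination of lower powers of w.
Detector : (V : Functionals) → ℕ → Set
Detector V n = ∃ λ x → (∀ i → i ℕ.< n → values x i ≡ 0ℤ) × values x n ≢ 0ℤ
  where open Functionals V

-- Gaussian elimination on the unknowns c₀, …, cₙ: a homogeneous system without nonzero
-- solution has a combination of its equations that isolates the last unknown.
eliminate : ∀ n (V : Functionals) (E : List (Functionals.X V)) →
  Relation V E n ⊎ (Detector V n × suc n ℕ.≤ length E)
eliminate n V E with pick (λ x → Functionals.values V x 0) E
eliminate zero V E | inj₁ z = inj₁ (1ℤ ∷ [] , refl , (λ { (() All.∷ _) }) , All.map (λ {x} → lemma x) z)
  where
  open Functionals V
  lemma : ∀ x → values x 0 ≡ 0ℤ → 1ℤ * values x 0 + 0ℤ ≡ 0ℤ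
  lemma x eq = cong (λ e → 1ℤ * e + 0ℤ) eq
eliminate zero V E | inj₂ (x , E′ , x≢0 , len , _) = inj₂ ((x , (λ i ()) , x≢0) , subst (1 ℕ.≤_) (sym len) (s≤s z≤n))
-- No equation involves c₀, so the first unit vector is a solution.
eliminate (suc n) V E | inj₁ z = inj₁ (1ℤ ∷ replicate (suc n) 0ℤ , cong suc (length-replicate (suc n)) , (λ { (() All.∷ _) }) , All.map (λ {x} → lemma x) z)
  where
  open Functionals V
  lemma : ∀ x → values x 0 ≡ 0ℤ → 1ℤ * values x 0 + dot (replicate (suc n) 0ℤ) (values x ∘ suc) ≡ 0ℤ
  lemma x eq = cong₂ (λ e e′ → 1ℤ * e + e′) eq (dot-zeros (suc n) (values x ∘ suc))
eliminate (suc n) V E | inj₂ (w , E′ , w≢0 , len , all) with eliminate n V′ (map reduce E′)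
  where
  open Functionals V
  -- The equations free of c₀, read in the remaining unknowns; `reduce` brings any equation into
  -- this form by cross-multiplication with the pivot w.
  V′ : Functionals
  V′ = record
    { X = Σ X (λ x → values x 0 ≡ 0ℤ)
    ; values = λ x i → values (proj₁ x) (suc i)
    ; combine = λ a x b y → combine a (proj₁ x) b (proj₁ y) ,
        trans (values-combine a (proj₁ x) b (proj₁ y) 0)
          (trans (cong₂ (λ s t → a * s + b * t) (proj₂ x) (proj₂ y)) (lemma a b))
    ; values-combine = λ a x b y i → values-combine a (proj₁ x) b (proj₁ y) (suc i)
    }
    where
    lemma : ∀ a b → a * 0ℤ + b * 0ℤ ≡ 0ℤ
    lemma = solve-∀
  reduce : X → Functionals.X V′
  reduce y = combine (values w 0) y (- values y 0) w , trans (values-combine (values w 0) y (- values y 0) w 0) (lemma (values w 0) (values y 0))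
    where
    lemma : ∀ a b → a * b + - b * a ≡ 0ℤ
    lemma = solve-∀
-- Elements of `V′` vanish at index 0, which gives the detector its additional zero; the pivot
-- raises the count of equations by one.
... | inj₂ ((x , zeros , x≢0) , bound) = inj₂ ((proj₁ x , zeros′ , x≢0) , subst (suc (suc n) ℕ.≤_) (sym len) (s≤s (subst (suc n ℕ.≤_) (length-map _ E′) bound)))
  where
  zeros′ : ∀ i → i ℕ.< suc n → Functionals.values V (proj₁ x) i ≡ 0ℤ
  zeros′ zero    _        = proj₂ x
  zeros′ (suc i) (s≤s i<) = zeros i i<
-- Back substitution: after scaling by the pivot coefficient, the pivot equation can be solved for
-- c₀ in ℤ.
... | inj₁ (c , lenc , c≢0 , rel) = inj₁ (- dot c (values w ∘ suc) ∷ scale (values w 0) c , cong suc (trans (length-map _ c) lenc) ,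
        (λ { (_ All.∷ z) → c≢0 (IsZero-scale⁻ (values w 0) c w≢0 z) }) , all solves-w (All.map (λ {y} → solves-y y) (map⁻ rel)))
  where
  open Functionals V
  open ≡-Reasoning
  solves-w : - dot c (values w ∘ suc) * values w 0 + dot (scale (values w 0) c) (values w ∘ suc) ≡ 0ℤ
  solves-w = trans (cong (λ e → - dot c (values w ∘ suc) * values w 0 + e) (dot-scale (values w 0) c (values w ∘ suc))) (lemma (dot c (values w ∘ suc)) (values w 0))
    where
    lemma : ∀ a b → - a * b + b * a ≡ 0ℤ
    lemma = solve-∀
  solves-y : ∀ y → dot c (λ i → values (combine (values w 0) y (- values y 0) w) (suc i)) ≡ 0ℤ →
    - dot c (values w ∘ suc) * values y 0 + dot (scale (values w 0) c) (values y ∘ suc) ≡ 0ℤ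
  solves-y y eq = begin
    - dot c (values w ∘ suc) * values y 0 + dot (scale (values w 0) c) (values y ∘ suc)
      ≡⟨ cong (λ e → - dot c (values w ∘ suc) * values y 0 + e) (dot-scale (values w 0) c (values y ∘ suc)) ⟩
    - dot c (values w ∘ suc) * values y 0 + values w 0 * dot c (values y ∘ suc)
      ≡⟨ lemma (dot c (values w ∘ suc)) (values y 0) (values w 0) (dot c (values y ∘ suc)) ⟩
    values w 0 * dot c (values y ∘ suc) + - values y 0 * dot c (values w ∘ suc)
      ≡⟨ dot-linear c (values w 0) (values y ∘ suc) (- values y 0) (values w ∘ suc) ⟨
    dot c (λ i → values w 0 * values y (suc i) + - values y 0 * values w (suc i))
      ≡⟨ ≋0⇒≡ (dot-cong c (λ i → ≡⇒≋ (sym (values-combine (values w 0) y (- values y 0) w (suc i))))) ⟩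
    dot c (λ i → values (combine (values w 0) y (- values y 0) w) (suc i))
      ≡⟨ eq ⟩
    0ℤ ∎
    where
    lemma : ∀ a y w b → - a * y + w * b ≡ w * b + - y * a
    lemma = solve-∀

-- Finite free algebras and their functionals

sumOver : ∀ {B : Set} → List B → (B → ℤ) → ℤ
sumOver []       g = 0ℤ
sumOver (b ∷ bs) g = g b + sumOver bs g

sumOver-cong : ∀ {B : Set} {q} (bs : List B) {g h : B → ℤ} → (∀ b → g b ≋ h b [ q ]) → sumOver bs g ≋ sumOver bs h [ q ]
sumOver-cong []       eq = ≋-refl
sumOver-cong (b ∷ bs) eq = ≋-+ (eq b) (sumOver-cong bs eq)

-- A finite free commutative ℤ-algebra, presented by the commutative monoid I of its monomials.
-- M q f says that f : I → ℤ defines a functional modulo q, i.e. respects the relations of the algebra;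
-- expand writes the monomial i as the combination of the basis monomials β with coefficients δ i.
record Context : Set₁ where
  infixl 7 _∙_
  field
    I         : Set
    _∙_       : I → I → I
    ε         : I
    ∙-assoc   : ∀ i j k → (i ∙ j) ∙ k ≡ i ∙ (j ∙ k)
    ∙-comm    : ∀ i j → i ∙ j ≡ j ∙ i
    identityʳ : ∀ i → i ∙ ε ≡ i
    M         : ℤ → (I → ℤ) → Set
    M-cong    : ∀ {q f g} → (∀ i → f i ≋ g i [ q ]) → M q f → M q g
    M-+       : ∀ {q f g} → M q f → M q g → M q (λ i → f i + g i)
    M-*       : ∀ {q f} c → M q f → M q (λ i → c * f i)
    M-shift   : ∀ {q f} i → M q f → M q (λ j → f (i ∙ j))
    M-mod     : ∀ {q f} → M 0ℤ f → M q f
    basis     : List (I × (I → ℤ))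
    basis-M   : All (λ b → M 0ℤ (proj₂ b)) basis
    expand    : ∀ {q f} → M q f → ∀ i j → f (i ∙ j) ≋ sumOver basis (λ b → proj₂ b i * f (proj₁ b ∙ j)) [ q ]

-- Elements of the algebra stay syntactic; their meaning is their action on functionals, which makes
-- normal forms unnecessary.
data Expr (I : Set) : Set where
  con     : ℤ → Expr I
  mon     : I → Expr I
  _⊕_ _⊗_ : Expr I → Expr I → Expr I

module Quotient (Γ : Context) where
  open Context Γ public

  -- The transpose of multiplication: `act e f` is the functional j ↦ f(e j).
  act : Expr I → (I → ℤ) → I → ℤ
  act (con c) f j = c * f j
  act (mon i) f j = f (i ∙ j)
  act (a ⊕ b) f j = act a f j + act b f j
  act (a ⊗ b) f j = act a (act b f) j

  act-cong : ∀ {q} e {f g} → (∀ j → f j ≋ g j [ q ]) → ∀ j → act e f j ≋ act e g j [ q ]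
  act-cong (con c) eq j = ≋-*ˡ c (eq j)
  act-cong (mon i) eq j = eq (i ∙ j)
  act-cong (a ⊕ b) eq j = ≋-+ (act-cong a eq j) (act-cong b eq j)
  act-cong (a ⊗ b) eq j = act-cong a (act-cong b eq) j

  act-cong-≡ : ∀ e {f g} → (∀ j → f j ≡ g j) → ∀ j → act e f j ≡ act e g j
  act-cong-≡ e eq j = ≋0⇒≡ (act-cong e (λ j → ≡⇒≋ (eq j)) j)

  act-+ : ∀ e f g j → act e (λ i → f i + g i) j ≡ act e f j + act e g j
  act-+ (con c) f g j = ℤ.*-distribˡ-+ c (f j) (g j)
  act-+ (mon i) f g j = refl
  act-+ (a ⊕ b) f g j = trans (cong₂ _+_ (act-+ a f g j) (act-+ b f g j)) (lemma (act a f j) (act a g j) (act b f j) (act b g j))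
    where
    lemma : ∀ a b c d → a + b + (c + d) ≡ a + c + (b + d)
    lemma = solve-∀
  act-+ (a ⊗ b) f g j = trans (act-cong-≡ a (act-+ b f g) j) (act-+ a (act b f) (act b g) j)

  act-* : ∀ e c f j → act e (λ i → c * f i) j ≡ c * act e f j
  act-* (con d) c f j = lemma d c (f j)
    where
    lemma : ∀ a b c → a * (b * c) ≡ b * (a * c)
    lemma = solve-∀
  act-* (mon i) c f j = refl
  act-* (a ⊕ b) c f j = trans (cong₂ _+_ (act-* a c f j) (act-* b c f j)) (sym (ℤ.*-distribˡ-+ c (act a f j) (act b f j)))
  act-* (a ⊗ b) c f j = trans (act-cong-≡ a (act-* b c f) j) (act-* a c (act b f) j)

  act-0 : ∀ e j → act e (λ _ → 0ℤ) j ≡ 0ℤ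
  act-0 e j = act-* e 0ℤ (λ _ → 0ℤ) j

  act-shift : ∀ e f i j → act e (λ k → f (i ∙ k)) j ≡ act e f (i ∙ j)
  act-shift (con c) f i j = refl
  act-shift (mon k) f i j = cong f (trans (sym (∙-assoc i k j)) (trans (cong (_∙ j) (∙-comm i k)) (∙-assoc k i j)))
  act-shift (a ⊕ b) f i j = cong₂ _+_ (act-shift a f i j) (act-shift b f i j)
  act-shift (a ⊗ b) f i j = trans (act-cong-≡ a (act-shift b f i) j) (act-shift a (act b f) i j)

  act-comm : ∀ a b f j → act a (act b f) j ≡ act b (act a f) j
  act-comm (con c)  b f j = sym (act-* b c f j)
  act-comm (mon i)  b f j = sym (act-shift b f i j)
  act-comm (a ⊕ a′) b f j = trans (cong₂ _+_ (act-comm a b f j) (act-comm a′ b f j)) (sym (act-+ b (act a f) (act a′ f) j))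
  act-comm (a ⊗ a′) b f j = trans (act-cong-≡ a (act-comm a′ b f) j) (act-comm a b (act a′ f) j)

  act-sum : ∀ {B : Set} e (bs : List B) (c : B → ℤ) (g : B → I → ℤ) j →
    act e (λ i → sumOver bs (λ b → c b * g b i)) j ≡ sumOver bs (λ b → c b * act e (g b) j)
  act-sum e []       c g j = act-0 e j
  act-sum e (b ∷ bs) c g j = trans (act-+ e (λ i → c b * g b i) (λ i → sumOver bs (λ b → c b * g b i)) j)
    (cong₂ _+_ (act-* e (c b) (g b) j) (act-sum e bs c g j))

  M-act : ∀ {q f} e → M q f → M q (act e f)
  M-act (con c) m = M-* c m
  M-act (mon i) m = M-shift i m
  M-act (a ⊕ b) m = M-+ (M-act a m) (M-act b m)
  M-act (a ⊗ b) m = M-act a (M-act b m)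

  infix 4 _≃_
  -- Ranging over all moduli q lets an identity that is derived once serve both for integral
  -- functionals (q = 0) and for functionals modulo p.
  record _≃_ (a b : Expr I) : Set where
    constructor equal
    field
      on : ∀ {q f} → M q f → ∀ j → act a f j ≋ act b f j [ q ]
  open _≃_ public

  algebra : ℤ-Algebra
  algebra = record
    { commutativeRing = record
      { Carrier = Expr I ; _≈_ = _≃_ ; _+_ = _⊕_ ; _*_ = _⊗_ ; -_ = con (- 1ℤ) ⊗_ ; 0# = con 0ℤ ; 1# = con 1ℤ
      ; isCommutativeRing = record
        { isRing = record
          { +-isAbelianGroup = record
            { isGroup = record
              { isMonoid = record
                { isSemigroup = record
                  { isMagma = record
                    { isEquivalence = record
                      { refl  = equal λ _ _ → ≋-refl
                      ; sym   = λ e → equal λ m j → ≋-sym (on e m j)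
                      ; trans = λ e e′ → equal λ m j → ≋-trans (on e m j) (on e′ m j)
                      }
                    ; ∙-cong = λ e e′ → equal λ m j → ≋-+ (on e m j) (on e′ m j)
                    }
                  ; assoc = λ a b c → equal λ {_} {f} _ j → ≡⇒≋ (ℤ.+-assoc (act a f j) (act b f j) (act c f j))
                  }
                ; identity = (λ a → equal λ _ j → ≡⇒≋ (+-identityˡ _)) , (λ a → equal λ _ j → ≡⇒≋ (+-identityʳ _))
                }
              ; inverse = (λ a → equal λ {_} {f} _ j → ≡⇒≋ (inverseˡ (act a f j) (f j))) , (λ a → equal λ {_} {f} _ j → ≡⇒≋ (inverseʳ (act a f j) (f j)))
              ; ⁻¹-cong = λ e → equal λ m j → ≋-*ˡ (- 1ℤ) (on e m j)
              }
            ; comm = λ a b → equal λ {_} {f} _ j → ≡⇒≋ (ℤ.+-comm (act a f j) (act b f j))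
            }
          -- The left factor is applied to `act b′ f`, which must therefore be a functional again.
          ; *-cong = λ {a} {a′} {b} {b′} e e′ → equal λ m j → ≋-trans (act-cong a (on e′ m) j) (on e (M-act b′ m) j)
          ; *-assoc = λ a b c → equal λ _ j → ≋-refl
          ; *-identity = (λ a → equal λ {_} {f} _ j → ≡⇒≋ (ℤ.*-identityˡ (act a f j))) , (λ a → equal λ {_} {f} _ j → ≡⇒≋ (act-cong-≡ a (λ i → ℤ.*-identityˡ (f i)) j))
          ; distrib = (λ a b c → equal λ {_} {f} _ j → ≡⇒≋ (act-+ a (act b f) (act c f) j)) , (λ a b c → equal λ _ j → ≋-refl)
          }
        ; *-comm = λ a b → equal λ {_} {f} _ j → ≡⇒≋ (act-comm a b f j)
        }
      }
    ; structureMap = record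
      { ⟦_⟧ = con
      ; +-homo = λ a b → equal λ {_} {f} _ j → ≡⇒≋ (ℤ.*-distribʳ-+ (f j) a b)
      ; *-homo = λ a b → equal λ {_} {f} _ j → ≡⇒≋ (ℤ.*-assoc a b (f j))
      ; -‿homo = λ a → equal λ {_} {f} _ j → ≡⇒≋ (neg a (f j))
      ; 0-homo = equal λ _ _ → ≋-refl
      ; 1-homo = equal λ _ _ → ≋-refl
      }
    }
    where
    inverseˡ : ∀ a b → - 1ℤ * a + a ≡ 0ℤ * b
    inverseˡ = solve-∀
    inverseʳ : ∀ a b → a + - 1ℤ * a ≡ 0ℤ * b
    inverseʳ = solve-∀
    neg : ∀ a b → - a * b ≡ - 1ℤ * (a * b)
    neg = solve-∀

  open Evaluation algebra public hiding (_≈ᴿ_; con)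

  -- By `expand`, every functional modulo any q is a combination of the dual basis, so finitely many
  -- integer equations force e = 0 for all moduli at once.
  vanish : ∀ e → All (λ b → act e (proj₂ b) ε ≡ 0ℤ) basis → e ≃ con 0ℤ
  vanish e zeros = equal λ {q} {f} m j → let open ≋-Reasoning q in begin
    act e f j                                                            ≡⟨ cong (act e f) (identityʳ j) ⟨
    act e f (j ∙ ε)                                                      ≡⟨ act-shift e f j ε ⟨
    act e (λ k → f (j ∙ k)) ε                                            ≈⟨ act-cong e (λ k → ≋-trans (≡⇒≋ (cong f (∙-comm j k))) (≋-trans (expand m k j) (sumOver-cong basis (λ b → ≡⇒≋ (ℤ.*-comm (proj₂ b k) (f (proj₁ b ∙ j))))))) ε ⟩
    act e (λ k → sumOver basis (λ b → f (proj₁ b ∙ j) * proj₂ b k)) ε    ≡⟨ act-sum e basis (λ b → f (proj₁ b ∙ j)) proj₂ ε ⟩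
    sumOver basis (λ b → f (proj₁ b ∙ j) * act e (proj₂ b) ε)            ≡⟨ sum-zero (λ b → f (proj₁ b ∙ j)) basis zeros ⟩
    0ℤ                                                                   ∎
    where
    sum-zero : ∀ (c : I × (I → ℤ) → ℤ) bs → All (λ b → act e (proj₂ b) ε ≡ 0ℤ) bs → sumOver bs (λ b → c b * act e (proj₂ b) ε) ≡ 0ℤ
    sum-zero c []       All.[]       = refl
    sum-zero c (b ∷ bs) (z All.∷ zs) = cong₂ _+_ (trans (cong (c b *_) z) (*-zeroʳ (c b))) (sum-zero c bs zs)

  -- The value `iterate w i f j` is f(wⁱ j).
  iterate : Expr I → ℕ → (I → ℤ) → I → ℤ
  iterate w zero    f = f
  iterate w (suc i) f = iterate w i (act w f)

  act-evalᴿ : ∀ c w f j → act (evalᴿ c w) f j ≡ dot c (λ i → iterate w i f j)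
  act-evalᴿ []      w f j = refl
  act-evalᴿ (a ∷ c) w f j = cong (λ e → a * f j + e) (trans (act-comm w (evalᴿ c w) f j) (act-evalᴿ c w (act w f) j))

  iterate-cong : ∀ {q} w i {f g} → (∀ j → f j ≋ g j [ q ]) → ∀ j → iterate w i f j ≋ iterate w i g j [ q ]
  iterate-cong w zero    eq = eq
  iterate-cong w (suc i) eq = iterate-cong w i (act-cong w eq)

  iterate-linear : ∀ w i a f b g j → iterate w i (λ k → a * f k + b * g k) j ≡ a * iterate w i f j + b * iterate w i g j
  iterate-linear w zero    a f b g j = refl
  iterate-linear w (suc i) a f b g j = trans
    (≋0⇒≡ (iterate-cong w i (λ k → ≡⇒≋ (trans (act-+ w (λ k → a * f k) (λ k → b * g k) k) (cong₂ _+_ (act-* w a f k) (act-* w b g k)))) j))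
    (iterate-linear w i a (act w f) b (act w g) j)

  functionals : Expr I → Functionals
  functionals w = record
    { X = Σ (I → ℤ) (M 0ℤ)
    ; values = λ x i → iterate w i (proj₁ x) ε
    ; combine = λ a x b y → (λ j → a * proj₁ x j + b * proj₁ y j) , M-+ (M-* a (proj₂ x)) (M-* b (proj₂ y))
    ; values-combine = λ a x b y i → iterate-linear w i a (proj₁ x) b (proj₁ y) ε
    }

  functionalsOf : ∀ {bs : List (I × (I → ℤ))} → All (λ b → M 0ℤ (proj₂ b)) bs → List (Σ (I → ℤ) (M 0ℤ))
  functionalsOf All.[]             = []
  functionalsOf (All._∷_ {b} m ms) = (proj₂ b , m) ∷ functionalsOf ms

  length-functionalsOf : ∀ {bs} (ms : All (λ b → M 0ℤ (proj₂ b)) bs) → length (functionalsOf ms) ≡ length bs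
  length-functionalsOf All.[]       = refl
  length-functionalsOf (m All.∷ ms) = cong suc (length-functionalsOf ms)

  relation⇒root : ∀ {n} w → (r : Relation (functionals w) (functionalsOf basis-M) n) → evalᴿ (proj₁ r) w ≃ con 0ℤ
  relation⇒root w (c , _ , _ , rel) = vanish (evalᴿ c w) (transfer basis-M rel)
    where
    transfer : ∀ {bs} (ms : All (λ b → M 0ℤ (proj₂ b)) bs) → All (λ x → dot c (λ i → iterate w i (proj₁ x) ε) ≡ 0ℤ) (functionalsOf ms) →
      All (λ b → act (evalᴿ c w) (proj₂ b) ε ≡ 0ℤ) bs
    transfer All.[]                  All.[]       = All.[]
    transfer (All._∷_ {b} m ms) (e All.∷ es) = trans (act-evalᴿ c w (proj₂ b) ε) e All.∷ transfer ms es

  -- With d = `length basis`, there are d equations for the coefficients of 1, w, ..., w^d, while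
  -- the detector outcome of the elimination would need d + 1.
  algebraic : ∀ w → ∃ λ c → ¬ IsZero c × evalᴿ c w ≃ con 0ℤ
  algebraic w with eliminate (length basis) (functionals w) (functionalsOf basis-M)
  ... | inj₁ r@(c , _ , c≢0 , _) = c , c≢0 , relation⇒root w r
  ... | inj₂ (_ , bound) = contradiction (subst (suc (length basis) ℕ.≤_) (length-functionalsOf basis-M) bound) (ℕ.<-irrefl refl)

  -- Minimality is recorded by its certificate: a functional vanishing on wⁱ for i < deg - 1 but not
  -- for i = deg - 1. In degree 0 a nonzero constant vanishes in the algebra.
  record MinimalRelation (w : Expr I) : Set where
    field
      body     : Poly
      lead     : ℤ
      lead≢0   : lead ≢ 0ℤ
      root     : evalᴿ (body ∷ʳ lead) w ≃ con 0ℤ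
      detector : body ≡ [] ⊎ ∃ λ m → length body ≡ suc m × Detector (functionals w) m

  -- Elimination on the powers of w below the current degree yields either a shorter relation, and
  -- the descent continues, or the detector.
  minimise : ∀ w k c → length c ℕ.≤ k → ¬ IsZero c → evalᴿ c w ≃ con 0ℤ → MinimalRelation w
  minimise w k c len c≢0 root with trim c
  ... | inj₁ z = contradiction z c≢0
  ... | inj₂ ([] , z , z≢0 , _ , c≐) = record { body = [] ; lead = z ; lead≢0 = z≢0
        ; root = ≈-trans (≈-sym (evalᴿ-≐ algebra c ([] ∷ʳ z) c≐ w)) root ; detector = inj₁ refl }
  minimise w (suc k) c len c≢0 root | inj₂ (a ∷ l , z , z≢0 , lenl , c≐) with eliminate (length l) (functionals w) (functionalsOf basis-M)
  ... | inj₂ (d , _) = record { body = a ∷ l ; lead = z ; lead≢0 = z≢0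
        ; root = ≈-trans (≈-sym (evalᴿ-≐ algebra c (a ∷ l ∷ʳ z) c≐ w)) root ; detector = inj₂ (length l , refl , d) }
  ... | inj₁ r@(c′ , len′ , c′≢0 , _) = minimise w k c′ (subst (ℕ._≤ k) (sym len′) (ℕ.≤-pred (ℕ.≤-trans lenl len))) c′≢0 (relation⇒root w r)
  minimise w zero c len c≢0 root | inj₂ (a ∷ l , z , z≢0 , lenl , c≐) with ℕ.≤-trans lenl len
  ... | ()

  minimalRelation : ∀ w → MinimalRelation w
  minimalRelation w = let (c , c≢0 , root) = algebraic w in minimise w (length c) c ℕ.≤-refl c≢0 root

-- Sums over sequences and lists

dot-cong-< : ∀ {q} c {s t : ℕ → ℤ} → (∀ i → i ℕ.< length c → s i ≋ t i [ q ]) → dot c s ≋ dot c t [ q ]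
dot-cong-< []      eq = ≋-refl
dot-cong-< (a ∷ c) eq = ≋-+ (≋-*ˡ a (eq 0 (s≤s z≤n))) (dot-cong-< c (λ i i< → eq (suc i) (s≤s i<)))

dot-cong-≡ : ∀ c {s t : ℕ → ℤ} → (∀ i → s i ≡ t i) → dot c s ≡ dot c t
dot-cong-≡ c eq = ≋0⇒≡ (dot-cong c (λ i → ≡⇒≋ (eq i)))

dot-+ : ∀ c (s t : ℕ → ℤ) → dot c (λ i → s i + t i) ≡ dot c s + dot c t
dot-+ c s t = begin
  dot c (λ i → s i + t i)               ≡⟨ dot-cong-≡ c (λ i → sym (lemma (s i) (t i))) ⟩
  dot c (λ i → 1ℤ * s i + 1ℤ * t i)     ≡⟨ dot-linear c 1ℤ s 1ℤ t ⟩
  1ℤ * dot c s + 1ℤ * dot c t           ≡⟨ lemma (dot c s) (dot c t) ⟩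
  dot c s + dot c t                     ∎
  where
  open ≡-Reasoning
  lemma : ∀ a b → 1ℤ * a + 1ℤ * b ≡ a + b
  lemma = solve-∀

dot-* : ∀ c a (s : ℕ → ℤ) → dot c (λ i → a * s i) ≡ a * dot c s
dot-* c a s = begin
  dot c (λ i → a * s i)                 ≡⟨ dot-cong-≡ c (λ i → sym (lemma a (s i))) ⟩
  dot c (λ i → a * s i + 0ℤ * s i)      ≡⟨ dot-linear c a s 0ℤ s ⟩
  a * dot c s + 0ℤ * dot c s            ≡⟨ lemma a (dot c s) ⟩
  a * dot c s                           ∎
  where
  open ≡-Reasoning
  lemma : ∀ a b → a * b + 0ℤ * b ≡ a * b
  lemma = solve-∀

dot-sum : ∀ {B : Set} c (bs : List B) (s : B → ℕ → ℤ) (d : B → ℤ) →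
  dot c (λ i → sumOver bs (λ b → s b i * d b)) ≡ sumOver bs (λ b → dot c (s b) * d b)
dot-sum c []       s d = dot-vanishing c (λ _ → 0ℤ) (λ _ _ → refl)
dot-sum c (b ∷ bs) s d = begin
  dot c (λ i → s b i * d b + sumOver bs (λ b → s b i * d b))              ≡⟨ dot-+ c (λ i → s b i * d b) _ ⟩
  dot c (λ i → s b i * d b) + dot c (λ i → sumOver bs (λ b → s b i * d b)) ≡⟨ cong₂ _+_ (trans (dot-cong-≡ c (λ i → ℤ.*-comm (s b i) (d b))) (trans (dot-* c (d b) (s b)) (ℤ.*-comm (d b) (dot c (s b))))) (dot-sum c bs s d) ⟩
  dot c (s b) * d b + sumOver bs (λ b → dot c (s b) * d b)                 ∎
  where open ≡-Reasoning

dot-geometric : ∀ {q} a c (g : ℕ → ℤ) → (∀ i → g (suc i) ≋ a * g i [ q ]) → dot c g ≋ eval c a * g 0 [ q ]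
dot-geometric a []      g geo = ≋-refl
dot-geometric {q} a (b ∷ c) g geo = begin
  b * g 0 + dot c (g ∘ suc)            ≈⟨ ≋-+ˡ (b * g 0) (dot-geometric a c (g ∘ suc) (geo ∘ suc)) ⟩
  b * g 0 + eval c a * g 1             ≈⟨ ≋-+ˡ (b * g 0) (≋-*ˡ (eval c a) (geo 0)) ⟩
  b * g 0 + eval c a * (a * g 0)       ≡⟨ lemma b (g 0) (eval c a) a ⟩
  (b + a * eval c a) * g 0             ∎
  where
  open ≋-Reasoning q
  lemma : ∀ b g e a → b * g + e * (a * g) ≡ (b + a * e) * g
  lemma = solve-∀

sumOver-map : ∀ {B C : Set} (F : B → C) bs (g : C → ℤ) → sumOver (map F bs) g ≡ sumOver bs (g ∘ F)
sumOver-map F []       g = refl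
sumOver-map F (b ∷ bs) g = cong (λ e → g (F b) + e) (sumOver-map F bs g)

sumOver-++ : ∀ {B : Set} (bs cs : List B) g → sumOver (bs ++ cs) g ≡ sumOver bs g + sumOver cs g
sumOver-++ []       cs g = sym (+-identityˡ _)
sumOver-++ (b ∷ bs) cs g = trans (cong (λ e → g b + e) (sumOver-++ bs cs g)) (sym (ℤ.+-assoc (g b) (sumOver bs g) (sumOver cs g)))

sumOver-* : ∀ {B : Set} a (bs : List B) g → a * sumOver bs g ≡ sumOver bs (λ b → a * g b)
sumOver-* a []       g = *-zeroʳ a
sumOver-* a (b ∷ bs) g = trans (ℤ.*-distribˡ-+ a (g b) (sumOver bs g)) (cong (λ e → a * g b + e) (sumOver-* a bs g))

sumOver-product : ∀ {B C D : Set} (F : B → C → D) bs cs g →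
  sumOver (cartesianProductWith F bs cs) g ≡ sumOver bs (λ b → sumOver cs (λ c → g (F b c)))
sumOver-product F []       cs g = refl
sumOver-product F (b ∷ bs) cs g = trans (sumOver-++ (map (F b) cs) _ g) (cong₂ _+_ (sumOver-map (F b) cs g) (sumOver-product F bs cs g))

kronecker : ℕ → ℕ → ℤ
kronecker k i with k ℕ.≟ i
... | yes _ = 1ℤ
... | no  _ = 0ℤ

kronecker-sum-0 : ∀ n i (g : ℕ → ℤ) → n ℕ.≤ i → sumOver (downFrom n) (λ k → kronecker k i * g k) ≡ 0ℤ
kronecker-sum-0 zero    i g n≤i = refl
kronecker-sum-0 (suc n) i g n<i with n ℕ.≟ i
... | yes refl = contradiction n<i (ℕ.<-irrefl refl)
... | no  _    = trans (+-identityˡ _) (kronecker-sum-0 n i g (ℕ.<⇒≤ n<i))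

kronecker-sum : ∀ n i (g : ℕ → ℤ) → i ℕ.< n → sumOver (downFrom n) (λ k → kronecker k i * g k) ≡ g i
kronecker-sum (suc n) i g (s≤s i≤n) with n ℕ.≟ i
... | yes refl = trans (cong₂ _+_ (ℤ.*-identityˡ (g n)) (kronecker-sum-0 n n g ℕ.≤-refl)) (+-identityʳ _)
... | no  n≢i  = trans (+-identityˡ _) (kronecker-sum n i g (ℕ.≤∧≢⇒< i≤n (n≢i ∘ sym)))

-- Quotients by one monic polynomial

-- The ring ℤ[x]/(P) for the monic polynomial P = l ∷ʳ 1; its functionals are the sequences satisfying the recurrence P.
module Univariate (l : Poly) where
  P : Poly
  P = l ∷ʳ 1ℤ

  n : ℕ
  n = length l

  -- Approximations by recursion depth; depth suc i suffices for the i-th term.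
  table : ℕ → ℕ → ℕ → ℤ
  table zero    k i = 0ℤ
  table (suc N) k i with i ℕ.<? n
  ... | yes _ = kronecker k i
  ... | no  _ = - dot l (λ h → table N k (h ℕ.+ (i ℕ.∸ n)))

  table-stable : ∀ N N′ k i → i ℕ.< N → i ℕ.< N′ → table N k i ≡ table N′ k i
  table-stable (suc N) (suc N′) k i (s≤s i≤N) (s≤s i≤N′) with i ℕ.<? n
  ... | yes _   = refl
  ... | no  i≮n = cong -_ (≋0⇒≡ (dot-cong-< l λ h h<n → ≡⇒≋ (table-stable N N′ k _ (below h h<n i≤N) (below h h<n i≤N′))))
    where
    below : ∀ {m} h → h ℕ.< n → i ℕ.≤ m → h ℕ.+ (i ℕ.∸ n) ℕ.< m
    below h h<n i≤m = ℕ.<-≤-trans (subst (h ℕ.+ (i ℕ.∸ n) ℕ.<_) (ℕ.m+[n∸m]≡n (ℕ.≮⇒≥ i≮n)) (ℕ.+-monoˡ-< (i ℕ.∸ n) h<n)) i≤m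

  -- For k < n, `δ k i` is the coefficient of xᵏ in the reduction of xⁱ modulo P.
  δ : ℕ → ℕ → ℤ
  δ k i = table (suc i) k i

  δ-initial : ∀ k i → i ℕ.< n → δ k i ≡ kronecker k i
  δ-initial k i i<n with i ℕ.<? n
  ... | yes _   = refl
  ... | no  i≮n = contradiction i<n i≮n

  δ-step : ∀ k j → δ k (n ℕ.+ j) ≡ - dot l (λ h → δ k (h ℕ.+ j))
  δ-step k j with n ℕ.+ j ℕ.<? n
  ... | yes lt = contradiction lt (ℕ.≤⇒≯ (ℕ.m≤m+n n j))
  ... | no  _  = cong -_ (≋0⇒≡ (dot-cong-< l λ h h<n → ≡⇒≋ (trans
          (cong (λ m → table (n ℕ.+ j) k (h ℕ.+ m)) (ℕ.m+n∸m≡n n j))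
          (table-stable (n ℕ.+ j) (suc (h ℕ.+ j)) k (h ℕ.+ j) (ℕ.+-monoˡ-< j h<n) ℕ.≤-refl))))

  -- The functional xⁱ ↦ f i annihilates every xʲ P, that is, the ideal (P) modulo q.
  Recurrent : ℤ → (ℕ → ℤ) → Set
  Recurrent q f = ∀ j → dot P (λ h → f (h ℕ.+ j)) ≋ 0ℤ [ q ]

  δ-recurrent : ∀ k → Recurrent 0ℤ (δ k)
  δ-recurrent k j = ≡⇒≋ (begin
    dot P (λ h → δ k (h ℕ.+ j))        ≡⟨ dot-∷ʳ l 1ℤ _ ⟩
    s + 1ℤ * δ k (n ℕ.+ j)             ≡⟨ cong (λ e → s + 1ℤ * e) (δ-step k j) ⟩
    s + 1ℤ * - s                       ≡⟨ lemma s ⟩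
    0ℤ                                 ∎)
    where
    open ≡-Reasoning
    s = dot l (λ h → δ k (h ℕ.+ j))
    lemma : ∀ s → s + 1ℤ * - s ≡ 0ℤ
    lemma = solve-∀

  recurrent-shift : ∀ {q f} i → Recurrent q f → Recurrent q (λ j → f (i ℕ.+ j))
  recurrent-shift {f = f} i rec j = ≋-trans (≡⇒≋ (dot-cong-≡ P λ h → cong f (lemma h))) (rec (i ℕ.+ j))
    where
    lemma : ∀ h → i ℕ.+ (h ℕ.+ j) ≡ h ℕ.+ (i ℕ.+ j)
    lemma h = trans (sym (ℕ.+-assoc i h j)) (trans (cong (ℕ._+ j) (ℕ.+-comm i h)) (ℕ.+-assoc h i j))

  -- The first n terms determine a recurrent sequence, and both sides are recurrent in i. `N` makes
  -- the strong induction structural.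
  recurrent-expand : ∀ {q g} → Recurrent q g → ∀ N i → i ℕ.< N → g i ≋ sumOver (downFrom n) (λ k → δ k i * g k) [ q ]
  recurrent-expand {q} {g} rec (suc N) i (s≤s i≤N) with ℕ.≤-<-connex n i
  ... | inj₂ i<n = ≡⇒≋ (trans (sym (kronecker-sum n i g i<n)) (≋0⇒≡ (sumOver-cong (downFrom n) λ k → ≡⇒≋ (cong (_* g k) (sym (δ-initial k i i<n))))))
  -- With i = n + j, the monic recurrence expresses g(n + j) through the n preceding terms.
  ... | inj₁ n≤i = subst (λ i → g i ≋ sumOver (downFrom n) (λ k → δ k i * g k) [ q ]) (ℕ.m+[n∸m]≡n n≤i) (begin
    g (n ℕ.+ j)
      ≡⟨ lemma (g (n ℕ.+ j)) (dot l (λ h → g (h ℕ.+ j))) ⟩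
    dot l (λ h → g (h ℕ.+ j)) + 1ℤ * g (n ℕ.+ j) + - dot l (λ h → g (h ℕ.+ j))
      ≡⟨ cong (_+ - dot l (λ h → g (h ℕ.+ j))) (dot-∷ʳ l 1ℤ _) ⟨
    dot P (λ h → g (h ℕ.+ j)) + - dot l (λ h → g (h ℕ.+ j))
      ≈⟨ ≋-+ (rec j) (≋-neg (dot-cong-< l λ h h<n → recurrent-expand rec N (h ℕ.+ j) (below h h<n))) ⟩
    0ℤ + - dot l (λ h → sumOver (downFrom n) (λ k → δ k (h ℕ.+ j) * g k))
      ≡⟨ cong (λ e → 0ℤ + - e) (dot-sum l (downFrom n) (λ k h → δ k (h ℕ.+ j)) g) ⟩
    0ℤ + - sumOver (downFrom n) (λ k → dot l (λ h → δ k (h ℕ.+ j)) * g k)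
      ≡⟨ lemma′ (sumOver (downFrom n) (λ k → dot l (λ h → δ k (h ℕ.+ j)) * g k)) ⟩
    - 1ℤ * sumOver (downFrom n) (λ k → dot l (λ h → δ k (h ℕ.+ j)) * g k)
      ≡⟨ sumOver-* (- 1ℤ) (downFrom n) _ ⟩
    sumOver (downFrom n) (λ k → - 1ℤ * (dot l (λ h → δ k (h ℕ.+ j)) * g k))
      ≈⟨ sumOver-cong (downFrom n) (λ k → ≡⇒≋ (trans (lemma″ (dot l (λ h → δ k (h ℕ.+ j))) (g k)) (cong (_* g k) (sym (δ-step k j))))) ⟩
    sumOver (downFrom n) (λ k → δ k (n ℕ.+ j) * g k) ∎)
    where
    open ≋-Reasoning q
    j = i ℕ.∸ n
    below : ∀ h → h ℕ.< n → h ℕ.+ j ℕ.< N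
    below h h<n = ℕ.<-≤-trans (subst (h ℕ.+ j ℕ.<_) (ℕ.m+[n∸m]≡n n≤i) (ℕ.+-monoˡ-< j h<n)) i≤N
    lemma : ∀ a b → a ≡ b + 1ℤ * a + - b
    lemma = solve-∀
    lemma′ : ∀ a → 0ℤ + - a ≡ - 1ℤ * a
    lemma′ = solve-∀
    lemma″ : ∀ a b → - 1ℤ * (a * b) ≡ - a * b
    lemma″ = solve-∀

  context : Context
  context = record
    { I = ℕ ; _∙_ = ℕ._+_ ; ε = 0 ; ∙-assoc = ℕ.+-assoc ; ∙-comm = ℕ.+-comm ; identityʳ = ℕ.+-identityʳ
    ; M = Recurrent
    ; M-cong = λ eq rec j → ≋-trans (dot-cong P (λ h → ≋-sym (eq (h ℕ.+ j)))) (rec j)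
    ; M-+ = λ {_} {f} {g} r r′ j → ≋-trans (≡⇒≋ (dot-+ P (λ h → f (h ℕ.+ j)) (λ h → g (h ℕ.+ j)))) (≋-+ (r j) (r′ j))
    ; M-* = λ {_} {f} c r j → ≋-trans (≡⇒≋ (dot-* P c (λ h → f (h ℕ.+ j)))) (≋-trans (≋-*ˡ c (r j)) (≡⇒≋ (*-zeroʳ c)))
    ; M-shift = λ {_} {f} → recurrent-shift {f = f}
    ; M-mod = λ r j → ≡⇒≋ (≋0⇒≡ (r j))
    ; basis = map (λ k → k , δ k) (downFrom n)
    ; basis-M = map⁺ (All.universal (λ k → δ-recurrent k) (downFrom n))
    -- For fixed j the shifted sequence i ↦ f (i + j) is recurrent as well.
    ; expand = λ {q} {f} rec i j → ≋-trans
        (recurrent-expand {g = λ i → f (i ℕ.+ j)} (λ h → ≋-trans (≡⇒≋ (dot-cong-≡ P λ k → cong f (ℕ.+-assoc k h j))) (rec (h ℕ.+ j))) (suc i) i ℕ.≤-refl)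
        (≡⇒≋ (sym (sumOver-map (λ k → k , δ k) (downFrom n) _)))
    }

  open Quotient context using (_≃_; equal; evalᴿ; act; act-evalᴿ; iterate)

  X : Expr ℕ
  X = mon 1

  iterate-X : ∀ i f j → iterate X i f j ≡ f (i ℕ.+ j)
  iterate-X zero    f j = refl
  iterate-X (suc i) f j = iterate-X i (λ j → f (suc j)) j

  X-root : evalᴿ P X ≃ con 0ℤ
  X-root = equal λ {q} {f} rec j → ≋-trans (≡⇒≋ (trans (act-evalᴿ P X f j) (dot-cong-≡ P (λ i → iterate-X i f j)))) (rec j)

  -- A root a modulo q is a homomorphism x ↦ a to ℤ/q; as a functional it is the sequence of powers
  -- of a.
  powers-recurrent : ∀ {q} a → eval P a ≋ 0ℤ [ q ] → Recurrent q (a ^_)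
  powers-recurrent a root j = ≋-trans (dot-geometric a P (λ h → a ^ (h ℕ.+ j)) (λ i → ≋-refl)) (≋-*ʳ (a ^ j) root)

-- Tensor products

-- Functionals on a tensor product are functions of two monomials that are functionals in each argument.
module Tensor (Γ Δ : Context) where
  private
    module Γ = Quotient Γ
    module Δ = Quotient Δ

  infixl 7 _⊠ᶠ_
  _⊠ᶠ_ : (Γ.I → ℤ) → (Δ.I → ℤ) → Γ.I × Δ.I → ℤ
  (f ⊠ᶠ g) (i , j) = f i * g j

  M⊗ : ℤ → (Γ.I × Δ.I → ℤ) → Set
  M⊗ q F = (∀ j → Γ.M q (λ i → F (i , j))) × (∀ i → Δ.M q (λ j → F (i , j)))

  M-⊠ᶠ : ∀ {q f g} → Γ.M q f → Δ.M q g → M⊗ q (f ⊠ᶠ g)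
  M-⊠ᶠ {f = f} {g} mf mg =
    (λ j → Γ.M-cong (λ i → ≡⇒≋ (ℤ.*-comm (g j) (f i))) (Γ.M-* (g j) mf)) , (λ i → Δ.M-* (f i) mg)

  pair : Γ.I × (Γ.I → ℤ) → Δ.I × (Δ.I → ℤ) → (Γ.I × Δ.I) × (Γ.I × Δ.I → ℤ)
  pair (β , f) (β′ , g) = (β , β′) , f ⊠ᶠ g

  pairs-M : ∀ {bs cs} → All (λ b → Γ.M 0ℤ (proj₂ b)) bs → All (λ c → Δ.M 0ℤ (proj₂ c)) cs →
    All (λ d → M⊗ 0ℤ (proj₂ d)) (cartesianProductWith pair bs cs)
  pairs-M All.[]       ns = All.[]
  pairs-M (m All.∷ ms) ns = ++⁺ (map⁺ (All.map (M-⊠ᶠ m) ns)) (pairs-M ms ns)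

  expand⊗ : ∀ {q F} → M⊗ q F → ∀ i j → F (proj₁ i Γ.∙ proj₁ j , proj₂ i Δ.∙ proj₂ j) ≋
    sumOver (cartesianProductWith pair Γ.basis Δ.basis) (λ b → proj₂ b i * F (proj₁ (proj₁ b) Γ.∙ proj₁ j , proj₂ (proj₁ b) Δ.∙ proj₂ j)) [ q ]
  expand⊗ {q} {F} (m , m′) (i , i′) (j , j′) = begin
    F (i Γ.∙ j , i′ Δ.∙ j′)
      ≈⟨ Γ.expand (m (i′ Δ.∙ j′)) i j ⟩
    sumOver Γ.basis (λ b → proj₂ b i * F (proj₁ b Γ.∙ j , i′ Δ.∙ j′))
      ≈⟨ sumOver-cong Γ.basis (λ b → ≋-trans (≋-*ˡ (proj₂ b i) (Δ.expand (m′ (proj₁ b Γ.∙ j)) i′ j′)) (≡⇒≋ (sumOver-* (proj₂ b i) Δ.basis _))) ⟩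
    sumOver Γ.basis (λ b → sumOver Δ.basis (λ c → proj₂ b i * (proj₂ c i′ * F (proj₁ b Γ.∙ j , proj₁ c Δ.∙ j′))))
      ≈⟨ sumOver-cong Γ.basis (λ b → sumOver-cong Δ.basis (λ c → ≡⇒≋ (sym (ℤ.*-assoc (proj₂ b i) (proj₂ c i′) (F (proj₁ b Γ.∙ j , proj₁ c Δ.∙ j′)))))) ⟩
    sumOver Γ.basis (λ b → sumOver Δ.basis (λ c → proj₂ b i * proj₂ c i′ * F (proj₁ b Γ.∙ j , proj₁ c Δ.∙ j′)))
      ≡⟨ sumOver-product pair Γ.basis Δ.basis (λ b → proj₂ b (i , i′) * F (proj₁ (proj₁ b) Γ.∙ j , proj₂ (proj₁ b) Δ.∙ j′)) ⟨
    sumOver (cartesianProductWith pair Γ.basis Δ.basis) (λ b → proj₂ b (i , i′) * F (proj₁ (proj₁ b) Γ.∙ j , proj₂ (proj₁ b) Δ.∙ j′)) ∎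
    where open ≋-Reasoning q

  context : Context
  context = record
    { I = Γ.I × Δ.I
    ; _∙_ = λ i j → proj₁ i Γ.∙ proj₁ j , proj₂ i Δ.∙ proj₂ j
    ; ε = Γ.ε , Δ.ε
    ; ∙-assoc = λ i j k → cong₂ _,_ (Γ.∙-assoc _ _ _) (Δ.∙-assoc _ _ _)
    ; ∙-comm = λ i j → cong₂ _,_ (Γ.∙-comm _ _) (Δ.∙-comm _ _)
    ; identityʳ = λ i → cong₂ _,_ (Γ.identityʳ _) (Δ.identityʳ _)
    ; M = M⊗
    ; M-cong = λ eq m → (λ j → Γ.M-cong (λ i → eq (i , j)) (proj₁ m j)) , (λ i → Δ.M-cong (λ j → eq (i , j)) (proj₂ m i))
    ; M-+ = λ m m′ → (λ j → Γ.M-+ (proj₁ m j) (proj₁ m′ j)) , (λ i → Δ.M-+ (proj₂ m i) (proj₂ m′ i))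
    ; M-* = λ c m → (λ j → Γ.M-* c (proj₁ m j)) , (λ i → Δ.M-* c (proj₂ m i))
    ; M-shift = λ i m → (λ j → Γ.M-shift (proj₁ i) (proj₁ m (proj₂ i Δ.∙ j))) , (λ j → Δ.M-shift (proj₂ i) (proj₂ m (proj₁ i Γ.∙ j)))
    ; M-mod = λ m → (λ j → Γ.M-mod (proj₁ m j)) , (λ i → Δ.M-mod (proj₂ m i))
    ; basis = cartesianProductWith pair Γ.basis Δ.basis
    ; basis-M = pairs-M Γ.basis-M Δ.basis-M
    ; expand = expand⊗
    }

  private module Θ = Quotient context

  inl : Expr Γ.I → Expr (Γ.I × Δ.I)
  inl (con c) = con c
  inl (mon i) = mon (i , Δ.ε)
  inl (a ⊕ b) = inl a ⊕ inl b
  inl (a ⊗ b) = inl a ⊗ inl b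

  inr : Expr Δ.I → Expr (Γ.I × Δ.I)
  inr (con c) = con c
  inr (mon i) = mon (Γ.ε , i)
  inr (a ⊕ b) = inr a ⊕ inr b
  inr (a ⊗ b) = inr a ⊗ inr b

  act-inl : ∀ e F i j → Θ.act (inl e) F (i , j) ≡ Γ.act e (λ i → F (i , j)) i
  act-inl (con c) F i j = refl
  act-inl (mon k) F i j = cong (λ j → F (k Γ.∙ i , j)) (trans (Δ.∙-comm Δ.ε j) (Δ.identityʳ j))
  act-inl (a ⊕ b) F i j = cong₂ _+_ (act-inl a F i j) (act-inl b F i j)
  act-inl (a ⊗ b) F i j = trans (act-inl a (Θ.act (inl b) F) i j) (Γ.act-cong-≡ a (λ i → act-inl b F i j) i)

  act-inr : ∀ e F i j → Θ.act (inr e) F (i , j) ≡ Δ.act e (λ j → F (i , j)) j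
  act-inr (con c) F i j = refl
  act-inr (mon k) F i j = cong (λ i → F (i , k Δ.∙ j)) (trans (Γ.∙-comm Γ.ε i) (Γ.identityʳ i))
  act-inr (a ⊕ b) F i j = cong₂ _+_ (act-inr a F i j) (act-inr b F i j)
  act-inr (a ⊗ b) F i j = trans (act-inr a (Θ.act (inr b) F) i j) (Δ.act-cong-≡ a (λ j → act-inr b F i j) j)

  inl-≃ : ∀ {a b} → a Γ.≃ b → inl a Θ.≃ inl b
  inl-≃ {a} {b} a≃b = Θ.equal λ { {q} {F} (m , _) (i , j) →
    ≋-trans (≡⇒≋ (act-inl a F i j)) (≋-trans (Γ.on a≃b (m j) i) (≡⇒≋ (sym (act-inl b F i j)))) }

  inr-≃ : ∀ {a b} → a Δ.≃ b → inr a Θ.≃ inr b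
  inr-≃ {a} {b} a≃b = Θ.equal λ { {q} {F} (_ , m) (i , j) →
    ≋-trans (≡⇒≋ (act-inr a F i j)) (≋-trans (Δ.on a≃b (m i) j) (≡⇒≋ (sym (act-inr b F i j)))) }

  inl-evalᴿ : ∀ p w → Θ.evalᴿ p (inl w) ≡ inl (Γ.evalᴿ p w)
  inl-evalᴿ []      w = refl
  inl-evalᴿ (a ∷ p) w = cong (λ e → con a ⊕ (inl w ⊗ e)) (inl-evalᴿ p w)

  inr-evalᴿ : ∀ p w → Θ.evalᴿ p (inr w) ≡ inr (Δ.evalᴿ p w)
  inr-evalᴿ []      w = refl
  inr-evalᴿ (a ∷ p) w = cong (λ e → con a ⊕ (inr w ⊗ e)) (inr-evalᴿ p w)

  inl-root : ∀ p {w} → Γ.evalᴿ p w Γ.≃ con 0ℤ → Θ.evalᴿ p (inl w) Θ.≃ con 0ℤ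
  inl-root p {w} root = subst (Θ._≃ con 0ℤ) (sym (inl-evalᴿ p w)) (inl-≃ root)

  inr-root : ∀ p {w} → Δ.evalᴿ p w Δ.≃ con 0ℤ → Θ.evalᴿ p (inr w) Θ.≃ con 0ℤ
  inr-root p {w} root = subst (Θ._≃ con 0ℤ) (sym (inr-evalᴿ p w)) (inr-≃ root)

-- Eigenvectors and separability

Root : ℕ → Poly → Set
Root p f = ∃ λ m → eval f m ≋ 0ℤ [ + p ]

length-quotientAt : ∀ {k} m p → length p ℕ.≤ suc k → length (quotientAt m p) ℕ.≤ k
length-quotientAt m []          len       = z≤n
length-quotientAt m (a ∷ [])    len       = z≤n
length-quotientAt {zero} m (a ∷ b ∷ p) (s≤s ())
length-quotientAt {suc k} m (a ∷ b ∷ p) (s≤s len) = length-⊞ (b ∷ p) (scale m (quotientAt m (b ∷ p))) len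
  (subst (ℕ._≤ suc k) (sym (length-map (m *_) (quotientAt m (b ∷ p)))) (ℕ.≤-trans (length-quotientAt m (b ∷ p) len) (ℕ.n≤1+n k)))

-- The quotient has degree one less than the polynomial and the same leading coefficient z; a
-- functional that vanishes on the lower powers sees only this coefficient.
dot-quotientAt : ∀ m a l z s → (∀ i → i ℕ.< length l → s i ≡ 0ℤ) → dot (quotientAt m (a ∷ l ∷ʳ z)) s ≡ z * s (length l)
dot-quotientAt m a l z s zeros = begin
  dot (l ∷ʳ z ⊞ scale m q) s                             ≡⟨ dot-⊞ (l ∷ʳ z) (scale m q) s ⟩
  dot (l ∷ʳ z) s + dot (scale m q) s                     ≡⟨ cong₂ _+_ (dot-∷ʳ l z s) (dot-scale m q s) ⟩
  dot l s + z * s (length l) + m * dot q s               ≡⟨ cong₂ (λ x y → x + z * s (length l) + m * y) (dot-vanishing l s zeros) (dot-vanishing q s (λ i i< → zeros i (ℕ.<-≤-trans i< (length-quotientAt m (l ∷ʳ z) (ℕ.≤-reflexive (length-∷ʳ l z)))))) ⟩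
  0ℤ + z * s (length l) + m * 0ℤ                         ≡⟨ lemma (z * s (length l)) m ⟩
  z * s (length l)                                       ∎
  where
  open ≡-Reasoning
  q = quotientAt m (l ∷ʳ z)
  lemma : ∀ a m → 0ℤ + a + m * 0ℤ ≡ a
  lemma = solve-∀

module Eigenvector (Γ : Context) where
  open Quotient Γ

  act-eigen : ∀ {q} c w {f} a → (∀ j → act w f j ≋ a * f j [ q ]) → ∀ j → act (evalᴿ c w) f j ≋ eval c a * f j [ q ]
  act-eigen []      w         a eig j = ≋-refl
  act-eigen {q} (b ∷ c) w {f} a eig j = begin
    b * f j + act w (act (evalᴿ c w) f) j      ≡⟨ cong (λ e → b * f j + e) (act-comm w (evalᴿ c w) f j) ⟩
    b * f j + act (evalᴿ c w) (act w f) j      ≈⟨ ≋-+ˡ (b * f j) (act-cong (evalᴿ c w) eig j) ⟩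
    b * f j + act (evalᴿ c w) (λ j → a * f j) j ≡⟨ cong (λ e → b * f j + e) (act-* (evalᴿ c w) a f j) ⟩
    b * f j + a * act (evalᴿ c w) f j          ≈⟨ ≋-+ˡ (b * f j) (≋-*ˡ a (act-eigen c w a eig j)) ⟩
    b * f j + a * (eval c a * f j)             ≡⟨ lemma b (f j) a (eval c a) ⟩
    (b + a * eval c a) * f j                   ∎
    where
    open ≋-Reasoning q
    lemma : ∀ b f a e → b * f + a * (e * f) ≡ (b + a * e) * f
    lemma = solve-∀

evalᴿ-ι : ∀ (A : ℤ-Algebra) → let open Evaluation A in ∀ p m → evalᴿ p (ι m) ≈ᴿ ι (eval p m)
evalᴿ-ι A []      m = ℤ-Algebra.≈-refl A
evalᴿ-ι A (a ∷ p) m = ≈-sym (≈-trans (+-homo a _) (+-congˡ (≈-trans (*-homo m _) (*-congˡ (≈-sym (evalᴿ-ι A p m))))))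
  where open Evaluation A

module Separability (A : ℤ-Algebra) where
  open Evaluation A
  open ≈ᴿ-Reasoning

  -- P(x₂) = P(x₁) + h P′(x₁) + h² s with P(x₁) = P(x₂) = 0; multiply by the Bézout cofactor b of P′.
  regular : ∀ p a b n₀ → (∀ x → eval a x * eval p x + eval b x * eval (derivative p) x ≡ n₀) →
    ∀ x₁ x₂ → evalᴿ p x₁ ≈ᴿ ι 0ℤ → evalᴿ p x₂ ≈ᴿ ι 0ℤ →
    ∃ λ r → ι n₀ *ᴿ (x₂ +ᴿ -ᴿ x₁) ≈ᴿ (x₂ +ᴿ -ᴿ x₁) *ᴿ (x₂ +ᴿ -ᴿ x₁) *ᴿ r
  regular p a b n₀ bézout x₁ x₂ root₁ root₂ with taylor₂ p x₁ x₂
  ... | s , taylor = -ᴿ (B *ᴿ s) , (begin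
    ι n₀ *ᴿ h                                                       ≈⟨ *-congʳ bézoutᴿ ⟨
    (A′ *ᴿ evalᴿ p x₁ +ᴿ B *ᴿ P′) *ᴿ h                               ≈⟨ *-congʳ (+-congʳ (*-congˡ root₁)) ⟩
    -- The bracket after B becomes the Taylor expansion of P(x₂) = 0 once its 0 is read as P(x₁).
    (A′ *ᴿ ι 0ℤ +ᴿ B *ᴿ P′) *ᴿ h                                     ≈⟨ solveᴿ 5 (λ A B P h s → (A :* con 0ℤ :+ B :* P) :* h := B :* (con 0ℤ :+ h :* P :+ h :* h :* s) :+ h :* h :* :- (B :* s)) ≈-refl A′ B P′ h s ⟩
    B *ᴿ (ι 0ℤ +ᴿ h *ᴿ P′ +ᴿ h *ᴿ h *ᴿ s) +ᴿ h *ᴿ h *ᴿ -ᴿ (B *ᴿ s)   ≈⟨ +-congʳ (*-congˡ (≈-trans (+-congʳ (+-congʳ (≈-sym root₁))) (≈-trans (≈-sym taylor) root₂))) ⟩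
    B *ᴿ ι 0ℤ +ᴿ h *ᴿ h *ᴿ -ᴿ (B *ᴿ s)                               ≈⟨ solveᴿ 3 (λ B h s → B :* con 0ℤ :+ h :* h :* :- (B :* s) := h :* h :* :- (B :* s)) ≈-refl B h s ⟩
    h *ᴿ h *ᴿ -ᴿ (B *ᴿ s)                                            ∎)
    where
    h  = x₂ +ᴿ -ᴿ x₁
    A′ = evalᴿ a x₁
    B  = evalᴿ b x₁
    P′ = evalᴿ (derivative p) x₁
    bézoutᴿ : A′ *ᴿ evalᴿ p x₁ +ᴿ B *ᴿ P′ ≈ᴿ ι n₀
    bézoutᴿ = begin
      A′ *ᴿ evalᴿ p x₁ +ᴿ B *ᴿ P′                          ≈⟨ +-cong (evalᴿ-⊠ a p x₁) (evalᴿ-⊠ b (derivative p) x₁) ⟨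
      evalᴿ (a ⊠ p) x₁ +ᴿ evalᴿ (b ⊠ derivative p) x₁      ≈⟨ evalᴿ-⊞ (a ⊠ p) (b ⊠ derivative p) x₁ ⟨
      evalᴿ (a ⊠ p ⊞ b ⊠ derivative p) x₁                  ≈⟨ evalᴿ-≐ A (a ⊠ p ⊞ b ⊠ derivative p) (n₀ ∷ []) constant x₁ ⟩
      ι n₀ +ᴿ x₁ *ᴿ ι 0ℤ                                   ≈⟨ solveᴿ 2 (λ n x → n :+ x :* con 0ℤ := n) ≈-refl (ι n₀) x₁ ⟩
      ι n₀                                                 ∎
      where
      constant : a ⊠ p ⊞ b ⊠ derivative p ≐ n₀ ∷ []
      constant x = trans (eval-⊞ (a ⊠ p) _ x) (trans (cong₂ _+_ (eval-⊠ a p x) (eval-⊠ b (derivative p) x))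
        (trans (bézout x) (trans (sym (+-identityʳ n₀)) (cong (λ e → n₀ + e) (sym (*-zeroʳ x))))))

  -- c(v r) = 0 makes c(−n₀ t) a multiple of v r + n₀ t, and (v r + n₀ t) h = r h (v + t h) by regularity of h.
  generic : ∀ c n₀ t h v r → ι n₀ *ᴿ h ≈ᴿ h *ᴿ h *ᴿ r → evalᴿ c (v *ᴿ r) ≈ᴿ ι 0ℤ →
    ∃ λ k → ι (- eval c (- n₀ * t)) *ᴿ h ≈ᴿ k *ᴿ (v +ᴿ ι t *ᴿ h)
  generic c n₀ t h v r reg root = K *ᴿ (r *ᴿ h) , (begin
    ι (- eval c m) *ᴿ h                                  ≈⟨ *-congʳ (-‿homo (eval c m)) ⟩
    -ᴿ ι (eval c m) *ᴿ h                                 ≈⟨ *-congʳ (-‿cong (evalᴿ-ι A c m)) ⟨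
    -ᴿ evalᴿ c (ι m) *ᴿ h                                ≈⟨ solveᴿ 2 (λ e h → (:- e) :* h := (con 0ℤ :+ :- e) :* h) ≈-refl (evalᴿ c (ι m)) h ⟩
    (ι 0ℤ +ᴿ -ᴿ evalᴿ c (ι m)) *ᴿ h                      ≈⟨ *-congʳ (+-congʳ root) ⟨
    (evalᴿ c w +ᴿ -ᴿ evalᴿ c (ι m)) *ᴿ h                 ≈⟨ *-congʳ (evalᴿ-quotientAt m c w) ⟩
    (w +ᴿ -ᴿ ι m) *ᴿ K *ᴿ h                              ≈⟨ *-congʳ (*-congʳ (+-congˡ (-‿cong (≈-trans (*-homo (- n₀) t) (*-congʳ (-‿homo n₀)))))) ⟩
    (v *ᴿ r +ᴿ -ᴿ (-ᴿ ι n₀ *ᴿ ι t)) *ᴿ K *ᴿ h            ≈⟨ solveᴿ 6 (λ v r n t K h → (v :* r :+ :- ((:- n) :* t)) :* K :* h := K :* (v :* r :* h :+ t :* (n :* h))) ≈-refl v r (ι n₀) (ι t) K h ⟩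
    K *ᴿ (v *ᴿ r *ᴿ h +ᴿ ι t *ᴿ (ι n₀ *ᴿ h))             ≈⟨ *-congˡ (+-congˡ (*-congˡ reg)) ⟩
    K *ᴿ (v *ᴿ r *ᴿ h +ᴿ ι t *ᴿ (h *ᴿ h *ᴿ r))           ≈⟨ solveᴿ 5 (λ v r t K h → K :* (v :* r :* h :+ t :* (h :* h :* r)) := K :* (r :* h) :* (v :+ t :* h)) ≈-refl v r (ι t) K h ⟩
    K *ᴿ (r *ᴿ h) *ᴿ (v +ᴿ ι t *ᴿ h)                     ∎)
    where
    w = v *ᴿ r
    m = - n₀ * t
    K = evalᴿ (quotientAt m c) w

-- Common roots of two monic polynomials

record CommonRoots (f g : Poly) : Set where
  field
    D   : Poly
    N   : ℤ
    N≢0 : N ≢ 0ℤ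
    to   : ∀ {p} → Prime p → ¬ (N ≋ 0ℤ [ + p ]) → Root p D → Root p f × Root p g
    from : ∀ {p} → Prime p → ¬ (N ≋ 0ℤ [ + p ]) → Root p f → Root p g → Root p D

record Separable (f : Poly) : Set where
  field
    a b    : Poly
    n₀     : ℤ
    n₀≢0   : n₀ ≢ 0ℤ
    bézout : ∀ x → eval a x * eval f x + eval b x * eval (derivative f) x ≡ n₀

-- `R₂` is A = ℤ[x, y]/(P(x), Q(y)) and `R₄` is A ⊗ A, with `inl` and `inr` as first and second
-- copy; thus h = x₂ - x₁ and v = y₂ - y₁.
module Monic (l k : Poly) where

  private
    module P = Univariate l
    module Q = Univariate k
    module T₂ = Tensor P.context Q.context
    module R₂ = Quotient T₂.context
    module T₄ = Tensor T₂.context T₂.context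
    module R₄ = Quotient T₄.context
    module S = Separability R₄.algebra
    open Eigenvector T₂.context

  x y : Expr R₂.I
  x = T₂.inl P.X
  y = T₂.inr Q.X

  x-root : R₂.evalᴿ P.P x R₂.≃ con 0ℤ
  x-root = T₂.inl-root P.P P.X-root

  y-root : R₂.evalᴿ Q.P y R₂.≃ con 0ℤ
  y-root = T₂.inr-root Q.P Q.X-root

  h v : Expr R₄.I
  h = T₄.inr x R₄.+ᴿ R₄.-ᴿ T₄.inl x
  v = T₄.inr y R₄.+ᴿ R₄.-ᴿ T₄.inl y

  -- Since v + t h = γ₂ - γ₁ for γ = y + t x, this says that γ separates the values of x once N is
  -- invertible.
  record Separation : Set where
    field
      N   : ℤ
      N≢0 : N ≢ 0ℤ
      t   : ℤ
      K   : Expr R₄.I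
      separates : con N ⊗ h R₄.≃ K ⊗ (v ⊕ (con t ⊗ h))

  separation : ∀ a b n₀ → n₀ ≢ 0ℤ → (∀ x → eval a x * eval P.P x + eval b x * eval (derivative P.P) x ≡ n₀) → Separation
  separation a b n₀ n₀≢0 bézout =
    fromRegular (S.regular P.P a b n₀ bézout (T₄.inl x) (T₄.inr x) (T₄.inl-root P.P x-root) (T₄.inr-root P.P x-root))
    where
    neg≡0 : ∀ a → - a ≡ 0ℤ → a ≡ 0ℤ
    neg≡0 a eq = trans (sym (ℤ.neg-involutive a)) (cong -_ eq)
    fromNonroot : ∀ r c → con n₀ ⊗ h R₄.≃ (h ⊗ h) ⊗ r → R₄.evalᴿ c (v ⊗ r) R₄.≃ con 0ℤ →
      (∃ λ t → t ≢ 0ℤ × eval c (- n₀ * t) ≢ 0ℤ) → Separation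
    fromNonroot r c reg root (t , _ , e≢0) = let (K , sep) = S.generic c n₀ t h v r reg root in
      record { N = - eval c (- n₀ * t) ; N≢0 = e≢0 ∘ neg≡0 _ ; t = t ; K = K ; separates = sep }
    fromAlgebraic : ∀ r → con n₀ ⊗ h R₄.≃ (h ⊗ h) ⊗ r → (∃ λ c → ¬ IsZero c × R₄.evalᴿ c (v ⊗ r) R₄.≃ con 0ℤ) → Separation
    fromAlgebraic r reg (c , c≢0 , root) =
      -- `generic` evaluates c at -n₀ t, so the nonroot has to be found among the multiples of -n₀.
      [ (λ z → contradiction z c≢0) , (λ nonroot → fromNonroot r c reg root (nonroot (- n₀) (n₀≢0 ∘ neg≡0 n₀))) ]′ (zero-or-nonroot c)
    fromRegular : (∃ λ r → con n₀ ⊗ h R₄.≃ (h ⊗ h) ⊗ r) → Separation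
    fromRegular (r , reg) = fromAlgebraic r reg (R₄.algebraic (v ⊗ r))

  generator : ℤ → Expr R₂.I
  generator t = y ⊕ (con t ⊗ x)

  module Generator (sep : Separation) (rel : R₂.MinimalRelation (generator (Separation.t sep))) where
    open Separation sep
    open R₂.MinimalRelation rel

    γ : Expr R₂.I
    γ = generator t

    D : Poly
    D = body ∷ʳ lead

    -- The homomorphism x ↦ α, y ↦ β is a functional modulo p on which γ acts as β + t α; applying
    -- D(γ) = 0 to it gives the root.
    from : ∀ {p} → Root p P.P → Root p Q.P → Root p D
    from {p} (α , rootα) (β , rootβ) = β + t * α , (begin
      eval D (β + t * α)                       ≡⟨ ℤ.*-identityʳ _ ⟨
      eval D (β + t * α) * f (0 , 0)           ≈⟨ act-eigen D γ (β + t * α) eigen (0 , 0) ⟨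
      R₂.act (R₂.evalᴿ D γ) f (0 , 0)          ≈⟨ R₂.on root (T₂.M-⊠ᶠ {f = α ^_} {g = β ^_} (P.powers-recurrent α rootα) (Q.powers-recurrent β rootβ)) (0 , 0) ⟩
      0ℤ                                       ∎)
      where
      open ≋-Reasoning (+ p)
      f : R₂.I → ℤ
      f = (α ^_) T₂.⊠ᶠ (β ^_)
      eigen : ∀ j → R₂.act γ f j ≋ (β + t * α) * f j [ + p ]
      eigen (i , j) = ≡⇒≋ (lemma (α ^ i) (β ^ j) α β t)
        where
        lemma : ∀ A B a b t → A * (b * B) + t * (a * A * B) ≡ (b + t * a) * (A * B)
        lemma = solve-∀

    -- An eigenvector φ of γ modulo p with φ(1) ≢ 0 turns out to be an eigenvector of x and of y,
    -- and the eigenvalues are the wanted roots.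
    module Common {p} (pr : Prime p) (N≢0ₚ : ¬ (N ≋ 0ℤ [ + p ])) (m : ℤ) (φ : R₂.I → ℤ) (M-φ : R₂.M (+ p) φ)
      (L≢0ₚ : ¬ (φ R₂.ε ≋ 0ℤ [ + p ])) (eigen : ∀ j → R₂.act γ φ j ≋ m * φ j [ + p ]) where
      open ≋-Reasoning (+ p)

      L : ℤ
      L = φ R₂.ε

      σ : R₄.I → ℤ
      σ = φ T₄.⊠ᶠ φ

      Xφ Yφ : R₂.I → ℤ
      Xφ = R₂.act x φ
      Yφ = R₂.act y φ

      act-inr-σ : ∀ e i j → R₄.act (T₄.inr e) σ (i , j) ≡ φ i * R₂.act e φ j
      act-inr-σ e i j = trans (T₄.act-inr e σ i j) (R₂.act-* e (φ i) φ j)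

      act-inl-σ : ∀ e i j → R₄.act (T₄.inl e) σ (i , j) ≡ φ j * R₂.act e φ i
      act-inl-σ e i j = trans (T₄.act-inl e σ i j) (trans (R₂.act-cong-≡ e (λ i → ℤ.*-comm (φ i) (φ j)) i) (R₂.act-* e (φ j) φ i))

      -- Both γ₁ and γ₂ act on φ ⊗ φ as m, and the operator is γ₂ - γ₁.
      killed : ∀ ij → R₄.act (v ⊕ (con t ⊗ h)) σ ij ≋ 0ℤ [ + p ]
      killed (i , j) = begin
        R₄.act (T₄.inr y) σ (i , j) + - 1ℤ * R₄.act (T₄.inl y) σ (i , j) + t * (R₄.act (T₄.inr x) σ (i , j) + - 1ℤ * R₄.act (T₄.inl x) σ (i , j))
          ≡⟨ cong₂ (λ V H → V + t * H) (cong₂ (λ a b → a + - 1ℤ * b) (act-inr-σ y i j) (act-inl-σ y i j)) (cong₂ (λ a b → a + - 1ℤ * b) (act-inr-σ x i j) (act-inl-σ x i j)) ⟩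
        φ i * Yφ j + - 1ℤ * (φ j * Yφ i) + t * (φ i * Xφ j + - 1ℤ * (φ j * Xφ i))
          ≡⟨ lemma₁ (φ i) (φ j) (Yφ i) (Yφ j) (Xφ i) (Xφ j) t ⟩
        φ i * (Yφ j + t * Xφ j) + - 1ℤ * (φ j * (Yφ i + t * Xφ i))
          ≈⟨ ≋-+ (≋-*ˡ (φ i) (eigen j)) (≋-*ˡ (- 1ℤ) (≋-*ˡ (φ j) (eigen i))) ⟩
        φ i * (m * φ j) + - 1ℤ * (φ j * (m * φ i))
          ≡⟨ lemma₂ (φ i) (φ j) m ⟩
        0ℤ ∎
        where
        lemma₁ : ∀ a b c d e f t → a * d + - 1ℤ * (b * c) + t * (a * f + - 1ℤ * (b * e)) ≡ a * (d + t * f) + - 1ℤ * (b * (c + t * e))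
        lemma₁ = solve-∀
        lemma₂ : ∀ a b m → a * (m * b) + - 1ℤ * (b * (m * a)) ≡ 0ℤ
        lemma₂ = solve-∀

      -- As p does not divide N, `separates` shows that h kills φ ⊗ φ too; at the pair (j, 1) this
      -- reads φ(j) φ(x) ≡ φ(1) φ(x j).
      proportional : ∀ j → L * Xφ j ≋ Xφ R₂.ε * φ j [ + p ]
      proportional j = begin
        L * Xφ j                                          ≡⟨ lemma (L * Xφ j) (φ j * Xφ R₂.ε) ⟩
        - 1ℤ * (φ j * Xφ R₂.ε + - 1ℤ * (L * Xφ j)) + φ j * Xφ R₂.ε  ≈⟨ ≋-+ʳ (φ j * Xφ R₂.ε) (≋-*ˡ (- 1ℤ) (cancel N _ pr N≢0ₚ annihilated)) ⟩
        - 1ℤ * 0ℤ + φ j * Xφ R₂.ε                        ≡⟨ trans (+-identityˡ _) (ℤ.*-comm (φ j) (Xφ R₂.ε)) ⟩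
        Xφ R₂.ε * φ j                                    ∎
        where
        lemma : ∀ a b → a ≡ - 1ℤ * (b + - 1ℤ * a) + b
        lemma = solve-∀
        annihilated : N * (φ j * Xφ R₂.ε + - 1ℤ * (L * Xφ j)) ≋ 0ℤ [ + p ]
        annihilated = begin
          N * (φ j * Xφ R₂.ε + - 1ℤ * (L * Xφ j))        ≡⟨ cong (N *_) (cong₂ (λ a b → a + - 1ℤ * b) (act-inr-σ x j R₂.ε) (act-inl-σ x j R₂.ε)) ⟨
          R₄.act (con N ⊗ h) σ (j , R₂.ε)                 ≈⟨ R₄.on separates {f = σ} (T₄.M-⊠ᶠ {f = φ} {g = φ} M-φ M-φ) (j , R₂.ε) ⟩
          R₄.act K (R₄.act (v ⊕ (con t ⊗ h)) σ) (j , R₂.ε) ≈⟨ R₄.act-cong K killed (j , R₂.ε) ⟩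
          R₄.act K (λ _ → 0ℤ) (j , R₂.ε)                  ≡⟨ R₄.act-0 K (j , R₂.ε) ⟩
          0ℤ                                              ∎

      common-roots : Root p P.P × Root p Q.P
      common-roots with inverse L pr L≢0ₚ
      ... | L⁻¹ , inv = (c , rootOf P.P x x-root c x-eigen) , (m + - (t * c) , rootOf Q.P y y-root _ y-eigen)
        where
        -- The eigenvalue of x is φ(x) / φ(1); that of y = γ - t x is then m - t c.
        c = L⁻¹ * Xφ R₂.ε
        x-eigen : ∀ j → Xφ j ≋ c * φ j [ + p ]
        x-eigen j = begin
          Xφ j                        ≡⟨ ℤ.*-identityˡ (Xφ j) ⟨
          1ℤ * Xφ j                   ≈⟨ ≋-*ʳ (Xφ j) inv ⟨
          L⁻¹ * L * Xφ j              ≡⟨ ℤ.*-assoc L⁻¹ L (Xφ j) ⟩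
          L⁻¹ * (L * Xφ j)            ≈⟨ ≋-*ˡ L⁻¹ (proportional j) ⟩
          L⁻¹ * (Xφ R₂.ε * φ j)      ≡⟨ ℤ.*-assoc L⁻¹ (Xφ R₂.ε) (φ j) ⟨
          c * φ j                    ∎
        y-eigen : ∀ j → Yφ j ≋ (m + - (t * c)) * φ j [ + p ]
        y-eigen j = begin
          Yφ j                                       ≡⟨ lemma₁ (Yφ j) (t * Xφ j) ⟩
          Yφ j + t * Xφ j + - (t * Xφ j)             ≈⟨ ≋-+ (eigen j) (≋-neg (≋-*ˡ t (x-eigen j))) ⟩
          m * φ j + - (t * (c * φ j))              ≡⟨ lemma₂ m (φ j) t c ⟩
          (m + - (t * c)) * φ j                     ∎
          where
          lemma₁ : ∀ a b → a ≡ a + b + - b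
          lemma₁ = solve-∀
          lemma₂ : ∀ m l t c → m * l + - (t * (c * l)) ≡ (m + - (t * c)) * l
          lemma₂ = solve-∀
        -- On φ the relation f(w) = 0 acts as f(d), and evaluation at 1 leaves the invertible factor
        -- φ(1).
        rootOf : ∀ f w → R₂.evalᴿ f w R₂.≃ con 0ℤ → ∀ d → (∀ j → R₂.act w φ j ≋ d * φ j [ + p ]) → eval f d ≋ 0ℤ [ + p ]
        rootOf f w root d eig = cancel L (eval f d) pr L≢0ₚ (begin
          L * eval f d                        ≡⟨ ℤ.*-comm L (eval f d) ⟩
          eval f d * L                        ≈⟨ act-eigen f w d eig R₂.ε ⟨
          R₂.act (R₂.evalᴿ f w) φ R₂.ε        ≈⟨ R₂.on root M-φ R₂.ε ⟩
          0ℤ                                  ∎)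

    commonRoots : CommonRoots P.P Q.P
    commonRoots with detector
    -- D is the nonzero constant `lead`, which has no root modulo a prime not dividing it.
    ... | inj₁ body≡[] = record
      { D = D ; N = lead ; N≢0 = lead≢0 ; from = λ _ _ → from
      ; to = λ { pr lead≢0ₚ (m , e) → contradiction (≋-trans (≡⇒≋ (constant m)) e) lead≢0ₚ } }
      where
      constant : ∀ m → lead ≡ eval D m
      constant m = trans (sym (+-identityʳ lead)) (trans (cong (λ e → lead + e) (sym (*-zeroʳ m))) (cong (λ b → eval (b ∷ʳ lead) m) (sym body≡[])))
    ... | inj₂ (d , len , (τ , M-τ) , zeros , val≢0) = record
      { D = D ; N = N * L ; N≢0 = *-≢0 N L N≢0 (*-≢0 lead (R₂.iterate γ d τ R₂.ε) lead≢0 val≢0) ; from = λ _ _ → from ; to = to }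
      where
      -- This is φ(1) for the φ built below from any root m: an integer independent of m and p, so
      -- it can enter the excluded factor.
      L = lead * R₂.iterate γ d τ R₂.ε
      to : ∀ {p} → Prime p → ¬ (N * L ≋ 0ℤ [ + p ]) → Root p D → Root p P.P × Root p Q.P
      to {p} pr NL≢0 (m , e) = Common.common-roots pr
        (λ z → NL≢0 (≋-*ʳ L z))
        m φ (R₂.M-mod {f = φ} (R₂.M-act {f = τ} (R₂.evalᴿ (quotientAt m D) γ) M-τ))
        (λ z → NL≢0 (≋-trans (≋-*ˡ N (≋-trans (≡⇒≋ (sym (value body len zeros))) z)) (≡⇒≋ (*-zeroʳ N))))
        eigen
        where
        open ≋-Reasoning (+ p)
        φ : R₂.I → ℤ
        φ = R₂.act (R₂.evalᴿ (quotientAt m D) γ) τ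
        value : ∀ body → length body ≡ suc d → (∀ i → i ℕ.< d → R₂.iterate γ i τ R₂.ε ≡ 0ℤ) →
          R₂.act (R₂.evalᴿ (quotientAt m (body ∷ʳ lead)) γ) τ R₂.ε ≡ L
        value (a₀ ∷ l′) refl zeros = trans (R₂.act-evalᴿ (quotientAt m (a₀ ∷ l′ ∷ʳ lead)) γ τ R₂.ε)
          (dot-quotientAt m a₀ l′ lead (λ i → R₂.iterate γ i τ R₂.ε) zeros)
        -- (γ - m) E(γ) = D(γ) - D(m), where D(γ) = 0 in A and D(m) ≡ 0 modulo p.
        eigen : ∀ j → R₂.act γ φ j ≋ m * φ j [ + p ]
        eigen j = begin
          R₂.act γ φ j                                              ≡⟨ lemma (R₂.act γ φ j) (m * φ j) ⟩
          R₂.act γ φ j + - 1ℤ * (m * φ j) + m * φ j               ≈⟨ ≋-+ʳ (m * φ j) (R₂.on (R₂.evalᴿ-quotientAt m D γ) (R₂.M-mod {f = τ} M-τ) j) ⟨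
          R₂.act (R₂.evalᴿ D γ) τ j + - 1ℤ * R₂.act (R₂.evalᴿ D (con m)) τ j + m * φ j
            ≈⟨ ≋-+ʳ (m * φ j) (≋-+ (R₂.on root (R₂.M-mod {f = τ} M-τ) j) (≋-*ˡ (- 1ℤ) (≋-trans (act-eigen D (con m) m (λ _ → ≋-refl) j) (≋-*ʳ (τ j) e)))) ⟩
          0ℤ + m * φ j                                              ≡⟨ +-identityˡ _ ⟩
          m * φ j                                                   ∎
          where
          lemma : ∀ a b → a ≡ a + - 1ℤ * b + b
          lemma = solve-∀

  commonRoots : Separable P.P → CommonRoots P.P Q.P
  commonRoots s = Generator.commonRoots sep (R₂.minimalRelation (generator (Separation.t sep)))
    where
    open Separable s
    sep = separation a b n₀ n₀≢0 bézout

-- Reduction to monic separable polynomials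

≋0? : ∀ q a → Dec (a ≋ 0ℤ [ q ])
≋0? q a = map′ ∣⇒≋0 ≋0⇒∣ (∣ q ∣ ℕ.∣? ∣ a ∣)

integral : ∀ {p} a b → Prime p → a * b ≋ 0ℤ [ + p ] → a ≋ 0ℤ [ + p ] ⊎ b ≋ 0ℤ [ + p ]
integral {p} a b pr ab≋0 with ≋0? (+ p) a
... | yes a≋0 = inj₁ a≋0
... | no  a≢0 = inj₂ (cancel a b pr a≢0 ab≋0)

*≋0ˡ : ∀ {q a} b → a ≋ 0ℤ [ q ] → a * b ≋ 0ℤ [ q ]
*≋0ˡ b a≋0 = ≋-*ʳ b a≋0

*≋0ʳ : ∀ {q b} a → b ≋ 0ℤ [ q ] → a * b ≋ 0ℤ [ q ]
*≋0ʳ a b≋0 = ≋-trans (≋-*ˡ a b≋0) (≡⇒≋ (*-zeroʳ a))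

record AlmostEqual (f g : Poly) : Set where
  field
    N    : ℤ
    N≢0  : N ≢ 0ℤ
    to   : ∀ {p} → Prime p → ¬ (N ≋ 0ℤ [ + p ]) → Root p f → Root p g
    from : ∀ {p} → Prime p → ¬ (N ≋ 0ℤ [ + p ]) → Root p g → Root p f

≐⇒AlmostEqual : ∀ f g → f ≐ g → AlmostEqual f g
≐⇒AlmostEqual f g f≐g = record { N = 1ℤ ; N≢0 = λ ()
  ; to   = λ _ _ (m , e) → m , ≋-trans (≡⇒≋ (sym (f≐g m))) e
  ; from = λ _ _ (m , e) → m , ≋-trans (≡⇒≋ (f≐g m)) e }

commonRoots-resp : ∀ {f f′ g g′} → AlmostEqual f f′ → AlmostEqual g g′ → CommonRoots f′ g′ → CommonRoots f g
commonRoots-resp ff gg c = record { D = C.D ; N = F.N * (G.N * C.N) ; N≢0 = *-≢0 F.N _ F.N≢0 (*-≢0 G.N C.N G.N≢0 C.N≢0)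
  ; to   = λ pr n r → let (rf , rg) = C.to pr (cN n) r in F.from pr (fN n) rf , G.from pr (gN n) rg
  ; from = λ pr n rf rg → C.from pr (cN n) (F.to pr (fN n) rf) (G.to pr (gN n) rg) }
  where
  module F = AlmostEqual ff
  module G = AlmostEqual gg
  module C = CommonRoots c
  fN : ∀ {q} → ¬ (F.N * (G.N * C.N) ≋ 0ℤ [ q ]) → ¬ (F.N ≋ 0ℤ [ q ])
  fN n z = n (*≋0ˡ _ z)
  gN : ∀ {q} → ¬ (F.N * (G.N * C.N) ≋ 0ℤ [ q ]) → ¬ (G.N ≋ 0ℤ [ q ])
  gN n z = n (*≋0ʳ F.N (*≋0ˡ C.N z))
  cN : ∀ {q} → ¬ (F.N * (G.N * C.N) ≋ 0ℤ [ q ]) → ¬ (C.N ≋ 0ℤ [ q ])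
  cN n z = n (*≋0ʳ F.N (*≋0ʳ G.N z))

-- For P = `l ∷ʳ z` of degree d, the lower coefficients of the monic polynomial z^(d-1) P(X / z).
monicBody : ℤ → Poly → Poly
monicBody z []      = []
monicBody z (a ∷ l) = a * z ^ length l ∷ monicBody z l

length-monicBody : ∀ z l → length (monicBody z l) ≡ length l
length-monicBody z []      = refl
length-monicBody z (a ∷ l) = cong suc (length-monicBody z l)

eval-monic : ∀ z l x → z * eval (monicBody z l ∷ʳ 1ℤ) (z * x) ≡ z ^ length l * eval (l ∷ʳ z) x
eval-monic z [] x = lemma z x
  where
  lemma : ∀ z x → z * (1ℤ + z * x * 0ℤ) ≡ 1ℤ * (z + x * 0ℤ)
  lemma = solve-∀
eval-monic z (a ∷ l) x = begin
  z * (a * Z + z * x * E)          ≡⟨ lemma₁ z a Z x E ⟩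
  z * (a * Z) + z * x * (z * E)    ≡⟨ cong (λ e → z * (a * Z) + z * x * e) (eval-monic z l x) ⟩
  z * (a * Z) + z * x * (Z * eval (l ∷ʳ z) x) ≡⟨ lemma₂ z a Z x (eval (l ∷ʳ z) x) ⟩
  z * Z * (a + x * eval (l ∷ʳ z) x) ∎
  where
  open ≡-Reasoning
  Z = z ^ length l
  E = eval (monicBody z l ∷ʳ 1ℤ) (z * x)
  lemma₁ : ∀ z a Z x E → z * (a * Z + z * x * E) ≡ z * (a * Z) + z * x * (z * E)
  lemma₁ = solve-∀
  lemma₂ : ∀ z a Z x e → z * (a * Z) + z * x * (Z * e) ≡ z * Z * (a + x * e)
  lemma₂ = solve-∀

cancel-^ : ∀ {p} z k b → Prime p → ¬ (z ≋ 0ℤ [ + p ]) → z ^ k * b ≋ 0ℤ [ + p ] → b ≋ 0ℤ [ + p ]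
cancel-^ z zero    b pr z≢0 e = ≋-trans (≡⇒≋ (sym (ℤ.*-identityˡ b))) e
cancel-^ z (suc k) b pr z≢0 e = cancel-^ z k b pr z≢0 (cancel z _ pr z≢0 (≋-trans (≡⇒≋ (sym (ℤ.*-assoc z (z ^ k) b))) e))

-- Multiplication by z permutes the residues modulo a prime not dividing z, and by `eval-monic` it
-- carries roots to roots in both directions.
monicise : ∀ l z → z ≢ 0ℤ → AlmostEqual (l ∷ʳ z) (monicBody z l ∷ʳ 1ℤ)
monicise l z z≢0 = record { N = z ; N≢0 = z≢0
  ; to   = λ pr n (m , e) → z * m , cancel z _ pr n (≋-trans (≡⇒≋ (eval-monic z l m)) (*≋0ʳ (z ^ length l) e))
  ; from = λ { pr n (m , e) → let (w , inv) = inverse z pr n in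
      w * m , cancel-^ z (length l) _ pr n (≋-trans (≡⇒≋ (sym (eval-monic z l (w * m))))
        (*≋0ʳ z (≋-trans (eval-≋ (monicBody z l ∷ʳ 1ℤ)
          (≋-trans (≡⇒≋ (lemma z w m)) (≋-trans (≋-*ʳ m inv) (≡⇒≋ (ℤ.*-identityˡ m))))) e))) } }
  where
  lemma : ∀ z w m → z * (w * m) ≡ w * z * m
  lemma = solve-∀

-- Outside the primes dividing n, S(f) = S(f₁) ∪ S(f₂); intersecting with S(g) distributes over the
-- union, and a product of polynomials realises it.
commonRoots-product : ∀ {f f₁ f₂ g} n → n ≢ 0ℤ → (∀ x → n * eval f x ≡ eval f₁ x * eval f₂ x) →
  CommonRoots f₁ g → CommonRoots f₂ g → CommonRoots f g
commonRoots-product {f} {f₁} {f₂} {g} n n≢0 factor c₁ c₂ = record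
  { D = C₁.D ⊠ C₂.D ; N = n * (C₁.N * C₂.N) ; N≢0 = *-≢0 n _ n≢0 (*-≢0 C₁.N C₂.N C₁.N≢0 C₂.N≢0) ; to = to ; from = from }
  where
  module C₁ = CommonRoots c₁
  module C₂ = CommonRoots c₂
  to : ∀ {p} → Prime p → ¬ (n * (C₁.N * C₂.N) ≋ 0ℤ [ + p ]) → Root p (C₁.D ⊠ C₂.D) → Root p f × Root p g
  to pr nn (m , e) with integral (eval C₁.D m) _ pr (≋-trans (≡⇒≋ (sym (eval-⊠ C₁.D C₂.D m))) e)
  ... | inj₁ e₁ = let ((m₁ , r₁) , rg) = C₁.to pr (λ z → nn (*≋0ʳ n (*≋0ˡ C₂.N z))) (m , e₁) in
          (m₁ , cancel n _ pr (λ z → nn (*≋0ˡ _ z)) (≋-trans (≡⇒≋ (factor m₁)) (*≋0ˡ (eval f₂ m₁) r₁))) , rg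
  ... | inj₂ e₂ = let ((m₂ , r₂) , rg) = C₂.to pr (λ z → nn (*≋0ʳ n (*≋0ʳ C₁.N z))) (m , e₂) in
          (m₂ , cancel n _ pr (λ z → nn (*≋0ˡ _ z)) (≋-trans (≡⇒≋ (factor m₂)) (*≋0ʳ (eval f₁ m₂) r₂))) , rg
  from : ∀ {p} → Prime p → ¬ (n * (C₁.N * C₂.N) ≋ 0ℤ [ + p ]) → Root p f → Root p g → Root p (C₁.D ⊠ C₂.D)
  from pr nn (m , e) rg with integral (eval f₁ m) _ pr (≋-trans (≡⇒≋ (sym (factor m))) (*≋0ʳ n e))
  ... | inj₁ e₁ = let (m₁ , r₁) = C₁.from pr (λ z → nn (*≋0ʳ n (*≋0ˡ C₂.N z))) (m , e₁) rg in
          m₁ , ≋-trans (≡⇒≋ (eval-⊠ C₁.D C₂.D m₁)) (*≋0ˡ (eval C₂.D m₁) r₁)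
  ... | inj₂ e₂ = let (m₂ , r₂) = C₂.from pr (λ z → nn (*≋0ʳ n (*≋0ʳ C₁.N z))) (m , e₂) rg in
          m₂ , ≋-trans (≡⇒≋ (eval-⊠ C₁.D C₂.D m₂)) (*≋0ʳ (eval C₁.D m₂) r₂)

record Factorisation (f : Poly) (bound : ℕ) : Set where
  field
    body₁ body₂ : Poly
    lead₁ lead₂ : ℤ
    lead₁≢0     : lead₁ ≢ 0ℤ
    lead₂≢0     : lead₂ ≢ 0ℤ
    length₁     : length body₁ ℕ.< bound
    length₂     : length body₂ ℕ.< bound
    n           : ℤ
    n≢0         : n ≢ 0ℤ
    factor      : ∀ x → n * eval f x ≡ eval (body₁ ∷ʳ lead₁) x * eval (body₂ ∷ʳ lead₂) x

-- The product on the right has the nonzero coefficient w y in degree deg u + deg g, so this degree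
-- is at most deg f; the other factor is nonconstant.
cofactor-length : ∀ f z n u w g y → w ≢ 0ℤ → y ≢ 0ℤ → 1 ℕ.≤ length g →
  (∀ x → n * eval (f ∷ʳ z) x ≡ eval (u ∷ʳ w) x * eval (g ∷ʳ y) x) → length u ℕ.< length f
cofactor-length f z n u w g y w≢0 y≢0 g≥1 eq = ℕ.≤-pred (ℕ.≤-trans (s≤s bound) (subst (length u ℕ.+ length g ℕ.<_) (length-∷ʳ f z)
    (nonzero-coeff⇒<length (f ∷ʳ z) λ c≡0 → *-≢0 w y w≢0 y≢0 (trans (sym coefficient) (trans (cong (n *_) c≡0) (*-zeroʳ n))))))
  where
  bound : suc (length u) ℕ.≤ length u ℕ.+ length g
  bound = subst (ℕ._≤ length u ℕ.+ length g) (ℕ.+-comm (length u) 1) (ℕ.+-monoʳ-≤ (length u) g≥1)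
  coefficient : n * coeff (f ∷ʳ z) (length u ℕ.+ length g) ≡ w * y
  coefficient = begin
    n * coeff (f ∷ʳ z) k              ≡⟨ coeff-scale n (f ∷ʳ z) k ⟨
    coeff (scale n (f ∷ʳ z)) k        ≡⟨ coeff-≐ (scale n (f ∷ʳ z)) ((u ∷ʳ w) ⊠ (g ∷ʳ y)) (λ x → trans (eval-scale n (f ∷ʳ z) x) (trans (eq x) (sym (eval-⊠ (u ∷ʳ w) (g ∷ʳ y) x)))) k ⟩
    coeff ((u ∷ʳ w) ⊠ (g ∷ʳ y)) k     ≡⟨ coeff-⊠-last u w g y ⟩
    w * y                             ∎
    where
    open ≡-Reasoning
    k = length u ℕ.+ length g

-- A constant gcd(f, f′) gives the Bézout identity; otherwise the gcd is a proper factor, its degree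
-- being at most deg f′ < deg f.
separable-or-factor : ∀ l z → z ≢ 0ℤ → Separable (l ∷ʳ z) ⊎ Factorisation (l ∷ʳ z) (length l)
separable-or-factor [] z z≢0 = inj₁ (record { a = 1ℤ ∷ [] ; b = [] ; n₀ = z ; n₀≢0 = z≢0 ; bézout = λ x → lemma z x (eval (derivative (z ∷ [])) x) })
  where
  lemma : ∀ z x d → (1ℤ + x * 0ℤ) * (z + x * 0ℤ) + 0ℤ * d ≡ z
  lemma = solve-∀
separable-or-factor l@(a ∷ l′) z z≢0 with trim (derivative (l ∷ʳ z))
-- In characteristic 0 a nonconstant f has f′ ≠ 0: its top coefficient is the degree times z.
... | inj₁ zero′ = contradiction (trans (sym (coeff-derivative (l ∷ʳ z) (length l′))) (coeff-IsZero zero′ (length l′)))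
        (*-≢0 (+ suc (length l′)) _ (λ ()) (λ e → z≢0 (trans (sym (coeff-last l′ z)) e)))
... | inj₂ (d , w , w≢0 , _ , d≐) with bézoutGCD (suc (length d)) (l ∷ʳ z) d w w≢0 ℕ.≤-refl
...   | gcd = cases (BézoutGCD.body gcd) refl
  where
  module G = BézoutGCD gcd
  degree : length d ℕ.< length l
  degree = ℕ.≤-pred (subst (suc (length d) ℕ.<_) (cong suc (length-∷ʳ l′ z))
    (nonzero-coeff⇒<length (l ∷ʳ z) λ c≡0 → w≢0 (begin
      w                                                       ≡⟨ coeff-last d w ⟨
      coeff (d ∷ʳ w) (length d)                               ≡⟨ coeff-≐ (derivative (l ∷ʳ z)) (d ∷ʳ w) d≐ (length d) ⟨
      coeff (derivative (l ∷ʳ z)) (length d)                  ≡⟨ coeff-derivative (l ∷ʳ z) (length d) ⟩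
      + suc (length d) * coeff (l ∷ʳ z) (suc (length d))      ≡⟨ cong (+ suc (length d) *_) c≡0 ⟩
      + suc (length d) * 0ℤ                                   ≡⟨ *-zeroʳ (+ suc (length d)) ⟩
      0ℤ                                                      ∎)))
    where open ≡-Reasoning
  cases : ∀ body → body ≡ G.body → Separable (l ∷ʳ z) ⊎ Factorisation (l ∷ʳ z) (length l)
  cases [] eq = inj₁ (record { a = G.a ; b = G.b ; n₀ = G.lead ; n₀≢0 = G.lead≢0 ; bézout = λ x → begin
      eval G.a x * eval (l ∷ʳ z) x + eval G.b x * eval (derivative (l ∷ʳ z)) x   ≡⟨ cong (λ e → eval G.a x * eval (l ∷ʳ z) x + eval G.b x * e) (d≐ x) ⟩
      eval G.a x * eval (l ∷ʳ z) x + eval G.b x * eval (d ∷ʳ w) x                ≡⟨ G.combination x ⟨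
      eval (G.body ∷ʳ G.lead) x                                                  ≡⟨ cong (λ b → eval (b ∷ʳ G.lead) x) eq ⟨
      G.lead + x * 0ℤ                                                            ≡⟨ cong (λ e → G.lead + e) (*-zeroʳ x) ⟩
      G.lead + 0ℤ                                                                ≡⟨ +-identityʳ G.lead ⟩
      G.lead                                                                     ∎ })
    where open ≡-Reasoning
  cases (b₀ ∷ b) eq with trim G.u
  -- The cofactor is nonzero because n f has leading coefficient n z ≠ 0.
  ... | inj₁ u≡0 = contradiction
          (trans (cong (G.n *_) (sym (coeff-last l z)))
            (trans (sym (coeff-scale G.n (l ∷ʳ z) (length l)))
              (coeff-≐ (scale G.n (l ∷ʳ z)) [] (λ x → trans (eval-scale G.n (l ∷ʳ z) x) (trans (G.divides-f x) (cong (_* eval (G.body ∷ʳ G.lead) x) (eval-IsZero x u≡0)))) (length l))))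
          (*-≢0 G.n z G.n≢0 z≢0)
  ... | inj₂ (u , y , y≢0 , _ , u≐) = inj₂ (record
          { body₁ = u ; body₂ = G.body ; lead₁ = y ; lead₂ = G.lead ; lead₁≢0 = y≢0 ; lead₂≢0 = G.lead≢0
          ; length₁ = cofactor-length l z G.n u y G.body G.lead y≢0 G.lead≢0 (subst (λ b → 1 ℕ.≤ length b) eq (s≤s z≤n)) factor
          ; length₂ = ℕ.≤-<-trans G.length-body degree
          ; n = G.n ; n≢0 = G.n≢0 ; factor = factor })
    where
    factor : ∀ x → G.n * eval (l ∷ʳ z) x ≡ eval (u ∷ʳ y) x * eval (G.body ∷ʳ G.lead) x
    factor x = trans (G.divides-f x) (cong (_* eval (G.body ∷ʳ G.lead) x) (u≐ x))

-- Induction on the degree of the first polynomial. Its factors need not be monic, so it has an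
-- arbitrary leading coefficient and is made monic anew in each call.
commonRoots-monic : ∀ k l z m → z ≢ 0ℤ → length l ℕ.< k → CommonRoots (l ∷ʳ z) (m ∷ʳ 1ℤ)
commonRoots-monic (suc k) l z m z≢0 (s≤s len) = commonRoots-resp (monicise l z z≢0) (≐⇒AlmostEqual (m ∷ʳ 1ℤ) (m ∷ʳ 1ℤ) (λ _ → refl)) reduced
  where
  l′ = monicBody z l
  reduced : CommonRoots (l′ ∷ʳ 1ℤ) (m ∷ʳ 1ℤ)
  reduced with separable-or-factor l′ 1ℤ (λ ())
  ... | inj₁ s = Monic.commonRoots l′ m s
  ... | inj₂ s = commonRoots-product n n≢0 factor
        (commonRoots-monic k body₁ lead₁ m lead₁≢0 (ℕ.<-≤-trans length₁ len′))
        (commonRoots-monic k body₂ lead₂ m lead₂≢0 (ℕ.<-≤-trans length₂ len′))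
    where
    open Factorisation s
    len′ : length l′ ℕ.≤ k
    len′ = subst (ℕ._≤ k) (sym (length-monicBody z l)) len

commonRoots : ∀ f g → CommonRoots f g
commonRoots f g with trim f | trim g
-- Every prime belongs to S(0), so the other polynomial is the intersection.
... | inj₁ f≡0 | _ = record { D = g ; N = 1ℤ ; N≢0 = λ () ; to = λ _ _ r → (0ℤ , ≡⇒≋ (eval-IsZero 0ℤ f≡0)) , r ; from = λ _ _ _ r → r }
... | inj₂ _ | inj₁ g≡0 = record { D = f ; N = 1ℤ ; N≢0 = λ () ; to = λ _ _ r → r , (0ℤ , ≡⇒≋ (eval-IsZero 0ℤ g≡0)) ; from = λ _ _ r _ → r }
... | inj₂ (l , z , z≢0 , _ , f≐) | inj₂ (m , w , w≢0 , _ , g≐) = commonRoots-resp (≐⇒AlmostEqual f (l ∷ʳ z) f≐) (≐⇒AlmostEqual g (m ∷ʳ w) g≐)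
      (commonRoots-resp (≐⇒AlmostEqual (l ∷ʳ z) (l ∷ʳ z) (λ _ → refl)) (monicise m w w≢0) (commonRoots-monic (suc (length l)) l z (monicBody w m) z≢0 ℕ.≤-refl))

-- Correcting finitely many primes

1≢0-mod-prime : ∀ {p} → Prime p → ¬ (1ℤ ≋ 0ℤ [ + p ])
1≢0-mod-prime {p} pr e with ℕ.∣1⇒≡1 (≋0⇒∣ e)
1≢0-mod-prime record { nontrivial = () } e | refl

-- Removing all primes dividing N′, wanted or not, makes it possible to add back exactly the wanted
-- ones by a constant factor.
record Purged (f : Poly) (N : ℤ) : Set where
  field
    g       : Poly
    N′      : ℤ
    N′≢0    : N′ ≢ 0ℤ
    N-good  : ∀ {q} → ¬ (N′ ≋ 0ℤ [ q ]) → ¬ (N ≋ 0ℤ [ q ])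
    no-root : ∀ {p} → Prime p → N′ ≋ 0ℤ [ + p ] → ¬ Root p g
    to      : ∀ {p} → Prime p → ¬ (N′ ≋ 0ℤ [ + p ]) → Root p f → Root p g
    from    : ∀ {p} → Prime p → ¬ (N′ ≋ 0ℤ [ + p ]) → Root p g → Root p f

-- With c₀ = f(c) ≠ 0 and N′ = c₀ N, the polynomial g(x) = f(c + c₀ N′ x) / c₀ is integral and ≡ 1 modulo N′.
purge : ∀ f N → N ≢ 0ℤ → Purged f N
purge f N N≢0 with zero-or-nonroot f
-- Without a nonzero value to divide by, 1 + N x serves: it is solvable modulo exactly the primes
-- that do not divide N.
... | inj₁ f≡0 = record { g = 1ℤ ∷ N ∷ [] ; N′ = N ; N′≢0 = N≢0 ; N-good = λ n → n
  ; no-root = λ { {p} pr N≋0 (m , e) → 1≢0-mod-prime pr (≋-trans (≡⇒≋ (sym (lemma₁ m))) (≋-trans (≋-+ˡ 1ℤ (≋-*ˡ m (≋-sym (≋-+ʳ (m * 0ℤ) N≋0)))) e)) }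
  ; to = λ { {p} pr n _ → let (c , inv) = inverse N pr n in - c ,
      ≋-trans (≡⇒≋ (lemma₂ c N)) (≋-+ˡ 1ℤ (≋-neg inv)) }
  ; from = λ _ _ _ → 0ℤ , ≡⇒≋ (eval-IsZero 0ℤ f≡0) }
  where
  lemma₁ : ∀ m → 1ℤ + m * (0ℤ + m * 0ℤ) ≡ 1ℤ
  lemma₁ = solve-∀
  lemma₂ : ∀ c N → 1ℤ + - c * (N + - c * 0ℤ) ≡ 1ℤ + - (c * N)
  lemma₂ = solve-∀
... | inj₂ nonroot = record { g = g ; N′ = N′ ; N′≢0 = *-≢0 c₀ N c₀≢0 N≢0 ; N-good = λ n z → n (*≋0ʳ c₀ z)
  ; no-root = λ { {p} pr N′≋0 (m , e) → 1≢0-mod-prime pr (≋-trans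
      (≋-sym (≋-trans (≡⇒≋ (eval-g m)) (≋-+ˡ 1ℤ (*≋0ʳ m (*≋0ˡ (eval E (c + m * (c₀ * N′))) N′≋0))))) e) }
  -- The congruence c + c₀ N′ x ≡ m is solvable for x because p divides neither c₀ nor N′.
  ; to = λ { {p} pr n (m , e) →
      let (w , inv) = inverse (c₀ * N′) pr (λ z → [ (λ z → n (*≋0ˡ N z)) , n ]′ (integral c₀ N′ pr z))
          x = w * (m + - c)
      in x , cancel c₀ _ pr (λ z → n (*≋0ˡ N z)) (≋-trans (≡⇒≋ (scaled x)) (≋-trans (eval-≋ f
           (≋-trans (≡⇒≋ (lemma₁ c w m (c₀ * N′))) (≋-trans (≋-+ˡ c (≋-*ʳ (m + - c) inv)) (≡⇒≋ (lemma₂ c m))))) e)) }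
  ; from = λ { pr n (m , e) → c + m * (c₀ * N′) , ≋-trans (≡⇒≋ (sym (scaled m))) (*≋0ʳ c₀ e) } }
  where
  c = 1ℤ * proj₁ (nonroot 1ℤ (λ ()))
  c₀ = eval f c
  c₀≢0 : c₀ ≢ 0ℤ
  c₀≢0 = proj₂ (proj₂ (nonroot 1ℤ (λ ())))
  N′ = c₀ * N
  E = quotientAt c f
  -- From f(X) = c₀ + (X - c) E(X) at X = c + c₀ N′ x, every term has the factor c₀; dividing it out
  -- leaves 1 + x N′ E(X).
  g = 1ℤ ∷ scale N′ (E ∘ₚ (c ∷ c₀ * N′ ∷ []))
  open ≡-Reasoning
  eval-g : ∀ x → eval g x ≡ 1ℤ + x * (N′ * eval E (c + x * (c₀ * N′)))
  eval-g x = cong (λ e → 1ℤ + x * e) (trans (eval-scale N′ (E ∘ₚ (c ∷ c₀ * N′ ∷ [])) x) (cong (N′ *_) (trans (eval-∘ E (c ∷ c₀ * N′ ∷ []) x) (cong (λ e → eval E (c + x * e)) (trans (cong (λ e → c₀ * N′ + e) (*-zeroʳ x)) (+-identityʳ _))))))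
  scaled : ∀ x → c₀ * eval g x ≡ eval f (c + x * (c₀ * N′))
  scaled x = begin
    c₀ * eval g x                                      ≡⟨ cong (c₀ *_) (eval-g x) ⟩
    c₀ * (1ℤ + x * (N′ * eval E X))                    ≡⟨ lemma c₀ x N′ (eval E X) c ⟩
    c₀ + (c + x * (c₀ * N′) + - c) * eval E X          ≡⟨ cong (λ e → c₀ + e) (eval-quotientAt c f X) ⟨
    c₀ + (eval f X + - c₀)                             ≡⟨ lemma′ c₀ (eval f X) ⟩
    eval f X                                           ∎
    where
    X = c + x * (c₀ * N′)
    lemma : ∀ d x N E c → d * (1ℤ + x * (N * E)) ≡ d + (c + x * (d * N) + - c) * E
    lemma = solve-∀
    lemma′ : ∀ a b → a + (b + - a) ≡ b
    lemma′ = solve-∀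
  lemma₁ : ∀ c w m d → c + w * (m + - c) * d ≡ c + w * d * (m + - c)
  lemma₁ = solve-∀
  lemma₂ : ∀ c m → c + 1ℤ * (m + - c) ≡ m
  lemma₂ = solve-∀

-- Deciding membership in S(P) and intersecting

S⇒Root : ∀ {f p} → S f p → Root p f
S⇒Root (_ , m , d) = m , ∣⇒≋0 d

Root⇒S : ∀ {f p} → Prime p → Root p f → S f p
Root⇒S pr (m , e) = pr , m , ≋0⇒∣ e

-- Being a root modulo p depends only on the residue, so a search through 0, ..., p - 1 decides.
S? : ∀ f p → Dec (S f p)
S? f p with prime? p
... | no ¬prime = no λ s → ¬prime (proj₁ s)
... | yes pr = map′ (λ { (i , d) → pr , + toℕ i , d }) residue (any? {n = p} (λ i → p ℕ.∣? ∣ eval f (+ toℕ i) ∣))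
  where
  instance _ = prime⇒nonZero pr
  residue : S f p → ∃ λ (i : Fin p) → (+ p) Unsigned.∣ eval f (+ toℕ i)
  residue (_ , m , d) = fromℕ< (n%ℕd<d m p) , ≋0⇒∣ (≋-trans (eval-≋ f reduce) (∣⇒≋0 d))
    where
    reduce : + toℕ (fromℕ< (n%ℕd<d m p)) ≋ m [ + p ]
    reduce = ≋-trans (≡⇒≋ (cong +_ (toℕ-fromℕ< (n%ℕd<d m p)))) (≋-sym (by-multiple (m /ℕ p) (a≡a%ℕn+[a/ℕn]*n m p)))

intersect : ∀ f g → Σ Poly λ D → ∀ p → S D p ⇔ (S f p × S g p)
intersect f g = scale (+ B) P.g , λ p → mk⇔ to from
  where
  module C = CommonRoots (commonRoots f g)
  module P = Purged (purge C.D C.N C.N≢0)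
  T? : ∀ p → Dec (S f p × S g p)
  T? p = S? f p ×-dec S? g p
  primes : List ℕ
  -- A prime dividing N′ is at most |N′|, and `upTo` excludes its bound. Primes in the list that do
  -- not divide N′ lie in both sets anyway, so adding them is harmless.
  primes = filter T? (upTo (suc ∣ P.N′ ∣))
  B : ℕ
  B = product primes
  to : ∀ {p} → S (scale (+ B) P.g) p → S f p × S g p
  to {p} (pr , m , d) with integral (+ B) (eval P.g m) pr (≋-trans (≡⇒≋ (sym (eval-scale (+ B) P.g m))) (∣⇒≋0 d))
  -- B is a product of primes, so a prime dividing it is one of the listed ones.
  ... | inj₁ B≋0 = proj₂ (∈-filter⁻ T? {xs = upTo (suc ∣ P.N′ ∣)} (factorisationHasAllPrimeFactors pr (≋0⇒∣ B≋0) (All.map (λ s → proj₁ (proj₁ s)) (all-filter T? (upTo (suc ∣ P.N′ ∣))))))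
  ... | inj₂ g≋0 with ≋0? (+ p) P.N′
  ...   | yes N≋0 = contradiction (m , g≋0) (P.no-root pr N≋0)
  ...   | no  N≢0 = let (rf , rg) = C.to pr (P.N-good N≢0) (P.from pr N≢0 (m , g≋0)) in Root⇒S {f} pr rf , Root⇒S {g} pr rg
  from : ∀ {p} → S f p × S g p → S (scale (+ B) P.g) p
  from {p} s@(sf@(pr , _) , sg) with ≋0? (+ p) P.N′
  ... | no N≢0 = let (m , e) = P.to pr N≢0 (C.from pr (P.N-good N≢0) (S⇒Root {f} sf) (S⇒Root {g} sg)) in
        Root⇒S {scale (+ B) P.g} pr (m , ≋-trans (≡⇒≋ (eval-scale (+ B) P.g m)) (*≋0ʳ (+ B) e))
  -- The constant B is divisible by p, so any argument is a root; 0 is taken.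
  ... | yes N≋0 = Root⇒S {scale (+ B) P.g} pr (0ℤ , ≋-trans (≡⇒≋ (eval-scale (+ B) P.g 0ℤ)) (*≋0ˡ (eval P.g 0ℤ) (∣⇒≋0 {a = + B} p∣B)))
    where
    p≤N′ : p ℕ.≤ ∣ P.N′ ∣
    p≤N′ = ℕ.∣⇒≤ {{ℕ.≢-nonZero (λ z → P.N′≢0 (ℤ.∣i∣≡0⇒i≡0 z))}} (≋0⇒∣ N≋0)
    p∣B : p ℕ.∣ B
    p∣B = ∈⇒∣product (∈-filter⁺ T? (∈-upTo⁺ (s≤s p≤N′)) s)

theorem1 : (k : ℕ) → (P : Fin (suc k) → Poly) →
    Σ Poly (λ D → (p : ℕ) → S D p ⇔ ((i : Fin (suc k)) → S (P i) p))
theorem1 zero P = P zero , λ p → mk⇔ (λ { s zero → s }) (λ s → s zero)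
theorem1 (suc k) P with theorem1 k (λ i → P (suc i))
... | D , D⇔ with intersect (P zero) D
...   | D′ , D′⇔ = D′ , λ p → mk⇔
        (λ { s zero    → proj₁ (Equivalence.to (D′⇔ p) s)
           ; s (suc i) → Equivalence.to (D⇔ p) (proj₂ (Equivalence.to (D′⇔ p) s)) i })
        (λ s → Equivalence.from (D′⇔ p) (s zero , Equivalence.from (D⇔ p) (λ i → s (suc i))))
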